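{- Let $p$ be an odd prime, let $n\ge0$ be an integer, let $F_n$ be the free pro-$p$-group on $n$ generators, and let $E$ be an open characteristic subgroup of $F_n$. Set $E_1:=\mathrm{Fr}(E)$ and $E_2:=\mho_1(E)[F_n,\mathrm{Fr}(E)]$. Then for any pro-$p$-group $G$ with $d(G)\le n$, the subgroup $E(G)$ is powerful if and only if $E_2(G)=E_1(G)$.
   Context: All homomorphisms of pro-$p$-groups are continuous, all subgroups closed, and generation is topological. $d(G)$ is the minimal number of generators of a pro-$p$-group $G$. $[A,B]$ is the closed subgroup generated by the commutators of elements of $A$ with elements of $B$; $\mho_1(G)$ is the closed subgroup generated by all $p$-th powers; $\mathrm{Fr}(G)=\mho_1(G)[G,G]$ is the Frattini subgroup. For odd $p$, a finitely generated pro-$p$-group $H$ is powerful if $\mho_1(H)=\mathrm{Fr}(H)$. A subgroup of $F_n$ is characteristic if it is invariant under all automorphisms of $F_n$. For a characteristic subgroup $E$ of $F_n$ and a pro-$p$-group $G$ with $d(G)\le n$, put $E(G):=\phi(E)$ for any surjective homomorphism $\phi\colon F_n\to G$; since $\phi$ is unique up to $\mathrm{Aut}(F_n)$, this is a characteristic subgroup of $G$ depending only on $E$ and $G$. Note that $E_1$ and $E_2$ are again characteristic (and open) in $F_n$, so that $E_1(G)$ and $E_2(G)$ are defined. -}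

module Defs where

open import Level using (Level; suc; _⊔_)
open import Algebra.Bundles using (Group)
import Algebra.Definitions.RawMonoid as Mult
open import Algebra.Morphism.Structures using (IsGroupHomomorphism)
open import Data.Fin.Base using (Fin)
open import Data.List.Base using (List)
open import Data.List.Relation.Unary.Any using (Any)
open import Data.Nat.Base using (ℕ; _≤_; _^_)
open import Data.Product.Base using (∃; ∃₂; _×_; _,_; proj₁; proj₂; uncurry)
open import Data.Product.Relation.Binary.Pointwise.NonDependent using (×-setoid)
open import Function.Definitions using (Congruent; Bijective; Surjective)
open import Relation.Binary.Bundles using (Setoid)
open import Relation.Binary.Definitions using (_Respects_)
open import Relation.Binary.PropositionalEquality.Core using (_≡_)
open import Relation.Nullary.Negation.Core using (¬_)
open import Relation.Unary using (Pred; _∈_; _⊆_; _≐_; _∩_; _≬_; _⊢_; _⟨×⟩_; ∁; Empty; U)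

private
  variable
    c a b ℓ : Level

-- A topology is presented by a base indexed by a small type. This keeps
-- closures predicative: with an arbitrary family of open sets as data, the
-- closure of a subset would live one universe above the subset.
record Topology {c} (S : Setoid c c) : Set (suc c) where
  open Setoid S
  field
    Index          : Set c
    Basic          : Index → Pred Carrier c
    Basic-respects : ∀ i → Basic i Respects _≈_
    Basic-covers   : ∀ x → ∃ λ i → x ∈ Basic i
    Basic-refines  : ∀ {x} i j → x ∈ Basic i ∩ Basic j →
                     ∃ λ k → x ∈ Basic k × Basic k ⊆ Basic i ∩ Basic j

  Open : Pred Carrier ℓ → Set (c ⊔ ℓ)
  Open V = ∀ {x} → x ∈ V → ∃ λ i → x ∈ Basic i × Basic i ⊆ V

  Closed : Pred Carrier ℓ → Set (c ⊔ ℓ)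
  Closed C = Open (∁ C)

  closure : Pred Carrier ℓ → Pred Carrier (c ⊔ ℓ)
  closure A x = ∀ i → x ∈ Basic i → Basic i ≬ A

  Hausdorff : Set (suc c)
  Hausdorff = ∀ x y → ¬ (x ≈ y) →
    ∃₂ λ (V W : Pred Carrier c) →
      Open V × Open W × x ∈ V × y ∈ W × Empty (V ∩ W)

  Compact : Set (suc c)
  Compact = {I : Set c} (V : I → Pred Carrier c) → (∀ i → Open (V i)) →
    (∀ x → ∃ λ i → x ∈ V i) →
    ∃ λ (is : List I) → ∀ x → Any (λ i → x ∈ V i) is

product : {S T : Setoid c c} → Topology S → Topology T → Topology (×-setoid S T)
product X Y = record
  { Index          = X.Index × Y.Index
  ; Basic          = λ (i , j) → X.Basic i ⟨×⟩ Y.Basic j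
  ; Basic-respects = λ (i , j) (e , f) (u , v) →
      X.Basic-respects i e u , Y.Basic-respects j f v
  ; Basic-covers   = λ (x , y) →
      let i , u = X.Basic-covers x ; j , v = Y.Basic-covers y
      in (i , j) , (u , v)
  ; Basic-refines  = λ (i , j) (i′ , j′) ((u , v) , (u′ , v′)) →
      let k , w , s = X.Basic-refines i i′ (u , u′)
          l , z , t = Y.Basic-refines j j′ (v , v′)
      in (k , l) , (w , z) , λ (m , n) →
           (proj₁ (s m) , proj₁ (t n)) , (proj₂ (s m) , proj₂ (t n))
  }
  where
  module X = Topology X
  module Y = Topology Y

Continuous : {S T : Setoid c c} → Topology S → Topology T →
             (Setoid.Carrier S → Setoid.Carrier T) → Set (suc c)
Continuous {c} {T = T} X Y f =
  {V : Pred (Setoid.Carrier T) c} → Topology.Open Y V → Topology.Open X (f ⊢ V)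

record TopologicalGroup (c : Level) : Set (suc c) where
  field
    group : Group c c
  open Group group public
  field
    topology      : Topology setoid
    ∙-continuous  : Continuous (product topology topology) topology (uncurry _∙_)
    ⁻¹-continuous : Continuous topology topology _⁻¹
  open Topology topology public

  record IsSubgroup (H : Pred Carrier ℓ) : Set (c ⊔ ℓ) where
    field
      respects  : H Respects _≈_
      ε-closed  : ε ∈ H
      ∙-closed  : ∀ {x y} → x ∈ H → y ∈ H → x ∙ y ∈ H
      ⁻¹-closed : ∀ {x} → x ∈ H → x ⁻¹ ∈ H

  record IsNormalSubgroup (N : Pred Carrier ℓ) : Set (c ⊔ ℓ) where
    field
      isSubgroup  : IsSubgroup N
      conj-closed : ∀ g {x} → x ∈ N → g ∙ x ∙ g ⁻¹ ∈ N

  _∼_mod_ : Carrier → Carrier → Pred Carrier ℓ → Set ℓ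
  x ∼ y mod H = x ⁻¹ ∙ y ∈ H

  HasIndex : Pred Carrier ℓ → ℕ → Set (c ⊔ ℓ)
  HasIndex H m = ∃ λ (f : Carrier → Fin m) →
    Congruent (λ x y → x ∼ y mod H) _≡_ f × Bijective (λ x y → x ∼ y mod H) _≡_ f

  data Generated (A : Pred Carrier ℓ) : Pred Carrier (c ⊔ ℓ) where
    gen  : ∀ {x} → x ∈ A → Generated A x
    unit : Generated A ε
    mul  : ∀ {x y} → Generated A x → Generated A y → Generated A (x ∙ y)
    inv  : ∀ {x} → Generated A x → Generated A (x ⁻¹)
    resp : ∀ {x y} → x ≈ y → Generated A x → Generated A y

  ⟪_⟫ : Pred Carrier ℓ → Pred Carrier (c ⊔ ℓ)
  ⟪ A ⟫ = closure (Generated A)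

  infixl 7 _·_
  _·_ : Pred Carrier a → Pred Carrier b → Pred Carrier (c ⊔ a ⊔ b)
  (A · B) x = ∃₂ λ y z → y ∈ A × z ∈ B × x ≈ y ∙ z

  [_,_] : Pred Carrier a → Pred Carrier b → Pred Carrier (c ⊔ a ⊔ b)
  [ A , B ] = ⟪ (λ x → ∃₂ λ y z → y ∈ A × z ∈ B × x ≈ y ⁻¹ ∙ z ⁻¹ ∙ y ∙ z) ⟫

  pow : ℕ → Carrier → Carrier
  pow = Mult._×_ rawMonoid

  -- The closed subgroup generated by a subset of a closed subgroup H is the
  -- same whether the closure is taken in H or in the ambient group, so
  -- ℧₁, Fr and powerfulness of H are expressed inside the ambient group.
  ℧₁ : ℕ → Pred Carrier ℓ → Pred Carrier (c ⊔ ℓ)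
  ℧₁ p H = ⟪ (λ x → ∃ λ y → y ∈ H × x ≈ pow p y) ⟫

  Fr : ℕ → Pred Carrier ℓ → Pred Carrier (c ⊔ ℓ)
  Fr p H = ℧₁ p H · [ H , H ]

  GeneratedBy : ℕ → Pred Carrier ℓ → Set (c ⊔ ℓ)
  GeneratedBy k H = ∃ λ (x : Fin k → Carrier) → ⟪ (λ g → ∃ λ i → g ≈ x i) ⟫ ≐ H

  record IsPowerful (p : ℕ) (H : Pred Carrier ℓ) : Set (c ⊔ ℓ) where
    field
      isSubgroup          : IsSubgroup H
      isClosed            : Closed H
      isFinitelyGenerated : ∃ λ k → GeneratedBy k H
      ℧₁≐Fr               : ℧₁ p H ≐ Fr p H

  IsMinimalNumberOfGenerators : ℕ → Set c
  IsMinimalNumberOfGenerators k = GeneratedBy k U × (∀ m → GeneratedBy m U → k ≤ m)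

  -- d(G) need not exist as a natural number (G may be infinitely generated).
  d≤_ : ℕ → Set c
  d≤ n = ∃ λ k → IsMinimalNumberOfGenerators k × k ≤ n

  -- A profinite group is a compact Hausdorff group whose open subgroups form a
  -- base of neighbourhoods of the identity; it is pro-p when all its open normal
  -- subgroups have p-power index.
  record IsProP (p : ℕ) : Set (suc c) where
    field
      compact          : Compact
      hausdorff        : Hausdorff
      open-subgroups   : {V : Pred Carrier c} → Open V → ε ∈ V →
                         ∃ λ (H : Pred Carrier c) → IsSubgroup H × Open H × H ⊆ V
      index-power-of-p : {N : Pred Carrier c} → IsNormalSubgroup N → Open N →
                         ∃ λ k → HasIndex N (p ^ k)

record ProPGroup (p : ℕ) (c : Level) : Set (suc c) where
  field
    topologicalGroup : TopologicalGroup c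
  open TopologicalGroup topologicalGroup public
  field
    isProP : IsProP p

module _ {p : ℕ} where

  record Hom (G H : ProPGroup p c) : Set (suc c) where
    private
      module G = ProPGroup G
      module H = ProPGroup H
    field
      ⟦_⟧            : G.Carrier → H.Carrier
      isHomomorphism : IsGroupHomomorphism G.rawGroup H.rawGroup ⟦_⟧
      continuous     : Continuous G.topology H.topology ⟦_⟧

    -- For G free on n generators, A characteristic and ⟦_⟧ surjective, this is
    -- the subgroup A(H); up to ≐ it does not depend on the surjection.
    image : Pred G.Carrier ℓ → Pred H.Carrier (c ⊔ ℓ)
    image A y = ∃ λ x → x ∈ A × ⟦ x ⟧ H.≈ y

    IsSurjective : Set c
    IsSurjective = Surjective G._≈_ H._≈_ ⟦_⟧

  record Aut (G : ProPGroup p c) : Set (suc c) where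
    open ProPGroup G
    field
      to      : Hom G G
      from    : Hom G G
      to∘from : ∀ x → Hom.⟦ to ⟧ (Hom.⟦ from ⟧ x) ≈ x
      from∘to : ∀ x → Hom.⟦ from ⟧ (Hom.⟦ to ⟧ x) ≈ x

  IsCharacteristic : (G : ProPGroup p c) → Pred (ProPGroup.Carrier G) ℓ → Set (suc c ⊔ ℓ)
  IsCharacteristic G E = (α : Aut G) → Hom.image (Aut.to α) E ≐ E

  module _ (F : ProPGroup p c) {n : ℕ} (x : Fin n → ProPGroup.Carrier F) where

    Extends : (G : ProPGroup p c) → (Fin n → ProPGroup.Carrier G) → Hom F G → Set c
    Extends G y φ = ∀ i → ProPGroup._≈_ G (Hom.⟦ φ ⟧ (x i)) (y i)

    IsFree : Set (suc c)
    IsFree = (G : ProPGroup p c) (y : Fin n → ProPGroup.Carrier G) →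
      ∃ λ (φ : Hom F G) → Extends G y φ ×
        (∀ (ψ : Hom F G) → Extends G y ψ →
          ∀ g → ProPGroup._≈_ G (Hom.⟦ ψ ⟧ g) (Hom.⟦ φ ⟧ g))

  E₁ : (F : ProPGroup p c) → Pred (ProPGroup.Carrier F) ℓ → Pred (ProPGroup.Carrier F) (c ⊔ ℓ)
  E₁ F E = Fr p E
    where open ProPGroup F

  E₂ : (F : ProPGroup p c) → Pred (ProPGroup.Carrier F) ℓ → Pred (ProPGroup.Carrier F) (c ⊔ ℓ)
  E₂ F E = ℧₁ p E · [ U , Fr p E ]
    where open ProPGroup F

{-# OPTIONS --safe #-}

-- Write H = E(G). If H is powerful then E₁(G) = Fr(H) = ℧₁(H) ⊆ E₂(G), and E₂(G) ⊆ ℧₁(H) since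
-- ℧₁(H) is closed and normal in G. Conversely, suppose Fr(H) = ℧₁(H)[G, Fr(H)]; it suffices
-- that Fr(H) ⊆ P for every open normal subgroup P ⊇ ℧₁(H) of G. The finite p-group G/P is trivial
-- or has a nontrivial centre Z/P; by induction on the index Fr(H) ⊆ Z, so [G, Fr(H)] ⊆ P and
-- Fr(H) = ℧₁(H)[G, Fr(H)] ⊆ P. The centre is nontrivial by the class equation. Compactness enters
-- through the tube lemma, which gives a base of open normal subgroups and shows that φ maps
-- closures onto closures; H is finitely generated by Schreier's lemma applied to a dense subgroup.

module Submission where

open import Defs
open import Algebra.Bundles using (Group)
open import Algebra.Morphism.Structures using (IsGroupHomomorphism)
import Algebra.Properties.Group as GroupProperties
open import Axiom.ExcludedMiddle using (ExcludedMiddle)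
open import Data.Bool.Base using (Bool; true; false; not; if_then_else_)
open import Data.Empty using (⊥-elim)
open import Data.Fin.Base using (Fin; zero; suc; punchIn; punchOut; combine; remQuot)
open import Data.Fin.Permutation using (Permutation′; permutation; _⟨$⟩ʳ_)
open import Data.Fin.Properties using (_≟_; any?; injective⇒≤; punchInᵢ≢i; punchIn-punchOut; remQuot-combine)
  renaming (suc-injective to fsuc-injective)
open import Data.List.Base using (List; []; _∷_)
open import Data.List.Relation.Unary.Any using (Any; here; there)
open import Data.Nat.Base using (ℕ; zero; suc; _+_; _*_; _^_; _≤_; _<_; z≤n)
open import Data.Nat.Divisibility using (_∣_; _∣0; divides; ∣m∣n⇒∣m+n; ∣m+n∣m⇒∣n; m∣m*n; ∣1⇒≡1)
open import Data.Nat.Primality using (Prime; euclidsLemma; ¬prime[1]; prime⇒nonZero)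
open import Data.Nat.Properties using (+-comm; +-identityʳ; +-0-commutativeMonoid; +-*-semiring; *-assoc; *-comm;
  *-identityʳ; *-zeroʳ; *-cancelˡ-≡; m+n≡0⇒m≡0; m*n≡1⇒n≡1; suc-injective; ≤-refl; ≤-trans; ≤-pred)
open import Algebra.Properties.CommutativeMonoid.Sum +-0-commutativeMonoid using (sum-remove; ∑-comm; sum-permute)
open import Algebra.Properties.Semiring.Sum +-*-semiring using (sum; sum-cong-≗; *-distribˡ-sum)
open import Data.Product.Base using (∃; ∃₂; _×_; _,_; proj₁; proj₂)
open import Data.Sum.Base using (_⊎_; inj₁; inj₂)
open import Data.Unit.Base using (tt)
open import Data.Vec.Base using (Vec; lookup)
open import Function.Base using (_∘_; id)
open import Function.Bundles using (_⇔_; mk⇔)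
open import Function.Definitions using (Congruent; Bijective; Injective)
open import Level using (Level)
open import Relation.Binary.Bundles using (Setoid)
open import Relation.Binary.Core using (Rel)
open import Relation.Binary.PropositionalEquality.Core as ≡ using (_≡_; _≢_)
import Relation.Binary.Reflection as Reflection
open import Relation.Binary.Structures using (IsEquivalence)
open import Relation.Nullary.Decidable.Core using (does; yes; no)
open import Relation.Nullary.Negation.Core using (¬_; contradiction)
open import Relation.Unary using (Pred; _∈_; _∉_; _⊆_; _≐_; _≬_; _⊢_; _∩_; U; ∁)

private
  variable
    c a b ℓ : Level

-- Group identities decided by free reduction of words, and conjugation identities.

module GroupSolver {c ℓ : Level} (G : Group c ℓ) where
  open Group G renaming (refl to ≈-refl; sym to ≈-sym; trans to ≈-trans)
  open GroupProperties G

  infixl 7 _⊕_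
  infix  8 ⊖_

  data Expr (n : ℕ) : Set where
    var : Fin n → Expr n
    ∅   : Expr n
    _⊕_ : Expr n → Expr n → Expr n
    ⊖_  : Expr n → Expr n

  ⟦_⟧ : ∀ {n} → Expr n → Vec Carrier n → Carrier
  ⟦ var i ⟧ ρ = lookup ρ i
  ⟦ ∅     ⟧ ρ = ε
  ⟦ a ⊕ b ⟧ ρ = ⟦ a ⟧ ρ ∙ ⟦ b ⟧ ρ
  ⟦ ⊖ a   ⟧ ρ = ⟦ a ⟧ ρ ⁻¹

  Word : ℕ → Set
  Word n = List (Bool × Fin n)

  signed : Bool → Carrier → Carrier
  signed true  x = x
  signed false x = x ⁻¹

  ⟦_⟧ʷ : ∀ {n} → Word n → Vec Carrier n → Carrier
  ⟦ []          ⟧ʷ ρ = ε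
  ⟦ (s , i) ∷ w ⟧ʷ ρ = signed s (lookup ρ i) ∙ ⟦ w ⟧ʷ ρ

  -- Words grow one letter at a time at the head, so cancelling against the first letter alone keeps
  -- a freely reduced word reduced.
  push : ∀ {n} → Bool → Fin n → Word n → Word n
  push s i [] = (s , i) ∷ []
  push s i ((t , j) ∷ w) with i ≟ j
  push true  i ((false , j) ∷ w) | yes _ = w
  push false i ((true  , j) ∷ w) | yes _ = w
  push s     i ((t     , j) ∷ w) | _     = (s , i) ∷ (t , j) ∷ w

  push-correct : ∀ {n} s (i : Fin n) w ρ → ⟦ push s i w ⟧ʷ ρ ≈ signed s (lookup ρ i) ∙ ⟦ w ⟧ʷ ρ
  push-correct s i [] ρ = ≈-refl
  push-correct s i ((t , j) ∷ w) ρ with i ≟ j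
  push-correct true  i ((true  , j) ∷ w) ρ | yes _      = ≈-refl
  push-correct true  i ((false , j) ∷ w) ρ | yes ≡.refl = ≈-sym (\\-leftDividesˡ _ _)
  push-correct false i ((true  , j) ∷ w) ρ | yes ≡.refl = ≈-sym (\\-leftDividesʳ _ _)
  push-correct false i ((false , j) ∷ w) ρ | yes _      = ≈-refl
  push-correct true  i ((_     , j) ∷ w) ρ | no _       = ≈-refl
  push-correct false i ((_     , j) ∷ w) ρ | no _       = ≈-refl

  -- The Boolean records whether the expression stands under an inverse. Inverses thus move down to
  -- the variables, reversing products on the way, and the accumulator replaces concatenation of
  -- words.
  reduce : ∀ {n} → Bool → Expr n → Word n → Word n
  reduce s     (var i) w = push s i w
  reduce s     ∅       w = w
  reduce true  (a ⊕ b) w = reduce true a (reduce true b w)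
  reduce false (a ⊕ b) w = reduce false b (reduce false a w)
  reduce s     (⊖ a)   w = reduce (not s) a w

  reduce-correct : ∀ {n} s (a : Expr n) w ρ → ⟦ reduce s a w ⟧ʷ ρ ≈ signed s (⟦ a ⟧ ρ) ∙ ⟦ w ⟧ʷ ρ
  reduce-correct s     (var i) w ρ = push-correct s i w ρ
  reduce-correct true  ∅       w ρ = ≈-sym (identityˡ _)
  reduce-correct false ∅       w ρ = ≈-sym (≈-trans (∙-congʳ ε⁻¹≈ε) (identityˡ _))
  reduce-correct true  (a ⊕ b) w ρ =
    ≈-trans (reduce-correct true a _ ρ)
      (≈-trans (∙-congˡ (reduce-correct true b w ρ)) (≈-sym (assoc _ _ _)))
  reduce-correct false (a ⊕ b) w ρ =
    ≈-trans (reduce-correct false b _ ρ)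
      (≈-trans (∙-congˡ (reduce-correct false a w ρ))
        (≈-trans (≈-sym (assoc _ _ _)) (∙-congʳ (≈-sym (⁻¹-anti-homo-∙ _ _)))))
  reduce-correct true  (⊖ a)   w ρ = reduce-correct false a w ρ
  reduce-correct false (⊖ a)   w ρ =
    ≈-trans (reduce-correct true a w ρ) (∙-congʳ (≈-sym (⁻¹-involutive _)))

  ⟦_⇓⟧ : ∀ {n} → Expr n → Vec Carrier n → Carrier
  ⟦ a ⇓⟧ = ⟦ reduce true a [] ⟧ʷ

  correct : ∀ {n} (a : Expr n) ρ → ⟦ a ⇓⟧ ρ ≈ ⟦ a ⟧ ρ
  correct a ρ = ≈-trans (reduce-correct true a [] ρ) (identityʳ _)

  open Reflection setoid var ⟦_⟧ ⟦_⇓⟧ correct public using (solve; _⊜_)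

  conj : Carrier → Carrier → Carrier
  conj g x = g ∙ x ∙ g ⁻¹

  conj-congˡ : ∀ g {x y} → x ≈ y → conj g x ≈ conj g y
  conj-congˡ g e = ∙-congʳ (∙-congˡ e)

  conj-congʳ : ∀ {g h} x → g ≈ h → conj g x ≈ conj h x
  conj-congʳ x e = ∙-cong (∙-congʳ e) (⁻¹-cong e)

  conj-∙ : ∀ g h x → conj (g ∙ h) x ≈ conj g (conj h x)
  conj-∙ = solve 3 (λ g h x → (g ⊕ h) ⊕ x ⊕ ⊖ (g ⊕ h) ⊜ g ⊕ (h ⊕ x ⊕ ⊖ h) ⊕ ⊖ g) ≈-refl

  conj-ε : ∀ x → conj ε x ≈ x
  conj-ε = solve 1 (λ x → ∅ ⊕ x ⊕ ⊖ ∅ ⊜ x) ≈-refl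

  conj-homo-ε : ∀ g → conj g ε ≈ ε
  conj-homo-ε = solve 1 (λ g → g ⊕ ∅ ⊕ ⊖ g ⊜ ∅) ≈-refl

  conj-homo-∙ : ∀ g x y → conj g (x ∙ y) ≈ conj g x ∙ conj g y
  conj-homo-∙ = solve 3 (λ g x y → g ⊕ (x ⊕ y) ⊕ ⊖ g ⊜ (g ⊕ x ⊕ ⊖ g) ⊕ (g ⊕ y ⊕ ⊖ g)) ≈-refl

  conj-homo-⁻¹ : ∀ g x → conj g (x ⁻¹) ≈ conj g x ⁻¹
  conj-homo-⁻¹ = solve 2 (λ g x → g ⊕ ⊖ x ⊕ ⊖ g ⊜ ⊖ (g ⊕ x ⊕ ⊖ g)) ≈-refl

  conj-cancel : ∀ g x → conj g (conj (g ⁻¹) x) ≈ x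
  conj-cancel = solve 2 (λ g x → g ⊕ (⊖ g ⊕ x ⊕ ⊖ ⊖ g) ⊕ ⊖ g ⊜ x) ≈-refl

  conj-cancel′ : ∀ g x → conj (g ⁻¹) (conj g x) ≈ x
  conj-cancel′ = solve 2 (λ g x → ⊖ g ⊕ (g ⊕ x ⊕ ⊖ g) ⊕ ⊖ ⊖ g ⊜ x) ≈-refl

  conj-injective : ∀ g {x y} → conj g x ≈ conj g y → x ≈ y
  conj-injective g {x} {y} e =
    ≈-trans (≈-sym (conj-cancel′ g x)) (≈-trans (conj-congˡ (g ⁻¹) e) (conj-cancel′ g y))

-- Counting by finite sums of indicators, and divisors of prime powers.

δ : ∀ {n} → Fin n → Fin n → ℕ
δ i j = if does (i ≟ j) then 1 else 0

δ-≡ : ∀ {n} {i j : Fin n} → i ≡ j → δ i j ≡ 1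
δ-≡ {i = i} {j} e with i ≟ j
... | yes _ = ≡.refl
... | no ¬e = contradiction e ¬e

δ-≢ : ∀ {n} {i j : Fin n} → i ≢ j → δ i j ≡ 0
δ-≢ {i = i} {j} ¬e with i ≟ j
... | yes e = contradiction e ¬e
... | no _  = ≡.refl

δ-cong : ∀ {m n} {i j : Fin m} {k l : Fin n} → (i ≡ j → k ≡ l) → (k ≡ l → i ≡ j) → δ i j ≡ δ k l
δ-cong {i = i} {j} to from with i ≟ j
... | yes e = ≡.sym (δ-≡ (to e))
... | no ¬e = ≡.sym (δ-≢ (¬e ∘ from))

sum-zero : ∀ {n} {t : Fin n → ℕ} → (∀ i → t i ≡ 0) → sum t ≡ 0
sum-zero {zero}  z = ≡.refl
sum-zero {suc n} z = ≡.cong₂ _+_ (z zero) (sum-zero (z ∘ suc))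

sum-single : ∀ {n} {t : Fin n → ℕ} i → (∀ j → j ≢ i → t j ≡ 0) → sum t ≡ t i
sum-single {suc n} {t} i z =
  ≡.trans (sum-remove {i = i} t)
    (≡.trans (≡.cong (t i +_) (sum-zero (λ j → z (punchIn i j) (punchInᵢ≢i i j)))) (+-identityʳ (t i)))

sum≡0⇒≡0 : ∀ {n} {t : Fin n → ℕ} → sum t ≡ 0 → ∀ i → t i ≡ 0
sum≡0⇒≡0 {suc n} {t} e i = m+n≡0⇒m≡0 (t i) (≡.trans (≡.sym (sum-remove {i = i} t)) e)

sum≡1⇒≡0 : ∀ {n} {t : Fin n → ℕ} i → t i ≡ 1 → sum t ≡ 1 → ∀ j → j ≢ i → t j ≡ 0
sum≡1⇒≡0 {suc n} {t} i tᵢ e j j≢i =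
  ≡.subst (λ k → t k ≡ 0) (punchIn-punchOut (j≢i ∘ ≡.sym)) (sum≡0⇒≡0 {t = t ∘ punchIn i} rest _)
  where
  rest : sum (t ∘ punchIn i) ≡ 0
  rest = suc-injective
    (≡.trans (≡.cong (_+ sum (t ∘ punchIn i)) (≡.sym tᵢ)) (≡.trans (≡.sym (sum-remove {i = i} t)) e))

∣-sum : ∀ {d n} {t : Fin n → ℕ} → (∀ i → d ∣ t i) → d ∣ sum t
∣-sum {n = zero}  _ = _ ∣0
∣-sum {n = suc n} d∣ = ∣m∣n⇒∣m+n (d∣ zero) (∣-sum (d∣ ∘ suc))

∣-sum⇒∣ : ∀ {d n} {t : Fin n → ℕ} i → (∀ j → j ≢ i → d ∣ t j) → d ∣ sum t → d ∣ t i
∣-sum⇒∣ {d} {suc n} {t} i d∣ d∣sum =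
  ∣m+n∣m⇒∣n (≡.subst (d ∣_) (≡.trans (sum-remove {i = i} t) (+-comm (t i) _)) d∣sum)
    (∣-sum (λ j → d∣ (punchIn i j) (punchInᵢ≢i i j)))

fibre : ∀ {m n} → (Fin m → Fin n) → Fin n → ℕ
fibre h j = sum (λ i → δ (h i) j)

-- Double counting: after exchanging the two sums, each `i` contributes exactly once, at `h i`.
sum-fibre : ∀ {m n} (h : Fin m → Fin n) → sum (fibre h) ≡ m
sum-fibre {m} h =
  ≡.trans (∑-comm (λ j i → δ (h i) j))
    (≡.trans (sum-cong-≗ (λ i →
      ≡.trans (sum-single (h i) (λ j j≢ → δ-≢ (j≢ ∘ ≡.sym))) (δ-≡ {i = h i} ≡.refl))) (ones m))
  where
  ones : ∀ n → sum {n} (λ _ → 1) ≡ n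
  ones zero    = ≡.refl
  ones (suc n) = ≡.cong suc (ones n)

fibre≡1⇒unique : ∀ {m n} {h : Fin m → Fin n} {j} → fibre h j ≡ 1 →
                 ∀ {a b} → h a ≡ j → h b ≡ j → b ≡ a
fibre≡1⇒unique {h = h} {j} e {a} {b} ha hb with b ≟ a
... | yes b≡a = b≡a
... | no b≢a  = contradiction
  (≡.trans (≡.sym (δ-≡ hb)) (sum≡1⇒≡0 {t = λ i → δ (h i) j} a (δ-≡ ha) e b b≢a)) λ ()

-- By Euclid's lemma `p` divides `o`, or it divides `d` and can be cancelled from both sides, which
-- lowers `k`.
∣p^k⇒p∣⊎≡1 : ∀ {p} → Prime p → ∀ k {d o} → d * o ≡ p ^ k → p ∣ o ⊎ o ≡ 1
∣p^k⇒p∣⊎≡1 pp zero {d} {o} e = inj₂ (m*n≡1⇒n≡1 d o e)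
∣p^k⇒p∣⊎≡1 {p} pp (suc k) {d} {o} e
  with euclidsLemma d o pp (≡.subst (p ∣_) (≡.sym e) (m∣m*n (p ^ k)))
... | inj₂ p∣o = inj₁ p∣o
... | inj₁ (divides d′ ≡.refl) = ∣p^k⇒p∣⊎≡1 pp k {d′} {o} (*-cancelˡ-≡ _ _ p {{prime⇒nonZero pp}}
        (≡.trans (≡.trans (≡.sym (*-assoc p d′ o)) (≡.cong (_* o) (*-comm p d′))) e))

-- The class equation and the centre of a finite p-group.

module _ (em : ∀ {ℓ} → ExcludedMiddle ℓ) where

  -- Each element is sent to the least member of its class, found by recursion on `n`. The classes
  -- become the nonempty fibres of `r`, so that they can be counted by `fibre`.
  representatives : ∀ {ℓ n} (_~_ : Rel (Fin n) ℓ) → IsEquivalence _~_ →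
    ∃ λ (r : Fin n → Fin n) → ∀ i j → (i ~ j → r i ≡ r j) × (r i ≡ r j → i ~ j)
  representatives {n = zero} _~_ eq = (λ i → i) , λ ()
  representatives {ℓ} {suc n} _~_ eq = r , r-correct
    where
    module ~ = IsEquivalence eq

    rec : ∃ λ (r : Fin n → Fin n) → ∀ i j → (suc i ~ suc j → r i ≡ r j) × (r i ≡ r j → suc i ~ suc j)
    rec = representatives (λ i j → suc i ~ suc j)
      (record { refl = ~.refl ; sym = ~.sym ; trans = ~.trans })

    r : Fin (suc n) → Fin (suc n)
    r zero    = zero
    r (suc i) = if does (em {P = zero ~ suc i}) then zero else suc (proj₁ rec i)

    r-correct : ∀ i j → (i ~ j → r i ≡ r j) × (r i ≡ r j → i ~ j)
    r-correct zero zero = (λ _ → ≡.refl) , (λ _ → ~.refl)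
    r-correct zero (suc j) with em {P = zero ~ suc j}
    ... | yes e = (λ _ → ≡.refl) , (λ _ → e)
    ... | no ¬e = (λ e → contradiction e ¬e) , λ ()
    r-correct (suc i) zero with em {P = zero ~ suc i}
    ... | yes e = (λ _ → ≡.refl) , (λ _ → ~.sym e)
    ... | no ¬e = (λ e → contradiction (~.sym e) ¬e) , λ ()
    r-correct (suc i) (suc j) with em {P = zero ~ suc i} | em {P = zero ~ suc j}
    ... | yes e | yes f = (λ _ → ≡.refl) , (λ _ → ~.trans (~.sym e) f)
    ... | yes e | no ¬f = (λ g → contradiction (~.trans e g) ¬f) , λ ()
    ... | no ¬e | yes f = (λ g → contradiction (~.trans f (~.sym g)) ¬e) , λ ()
    ... | no ¬e | no ¬f = (λ g → ≡.cong suc (proj₁ (proj₂ rec i j) g))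
                        , (λ g → proj₂ (proj₂ rec i j) (fsuc-injective g))

  module _ {p : ℕ} (pp : Prime p) {k : ℕ} {c ℓ : Level} (Q : Group c ℓ) where
    open Group Q renaming (refl to ≈-refl; sym to ≈-sym; trans to ≈-trans)
    open GroupSolver Q
    open GroupProperties Q using (\\-leftDividesˡ; \\-leftDividesʳ)

    -- Suppose only `ε` is central. The class of `ε` has one element and every other class has size
    -- divisible by `p`; as the sizes add up to `p ^ suc k`, this forces `p ∣ 1`.
    centre-nontrivial : (f : Carrier → Fin (p ^ suc k)) → Congruent _≈_ _≡_ f → Bijective _≈_ _≡_ f →
      ∃ λ z → ¬ z ≈ ε × ∀ g → conj g z ≈ z
    centre-nontrivial f f-cong (f-inj , f-surj) with em {P = ∃ λ z → ¬ z ≈ ε × ∀ g → conj g z ≈ z}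
    ... | yes found = found
    ... | no ¬found = ⊥-elim (¬prime[1] (≡.subst Prime (∣1⇒≡1 p∣1) pp))
      where
      q = p ^ suc k

      s : Fin q → Carrier
      s i = proj₁ (f-surj i)

      f∘s : ∀ i → f (s i) ≡ i
      f∘s i = proj₂ (f-surj i) ≈-refl

      s∘f : ∀ x → s (f x) ≈ x
      s∘f x = f-inj (f∘s (f x))

      central⇒≈ε : ∀ z → (∀ g → conj g z ≈ z) → z ≈ ε
      central⇒≈ε z cz with em {P = z ≈ ε}
      ... | yes e = e
      ... | no ¬e = contradiction (z , ¬e , cz) ¬found

      -- Conjugacy is transported along `f` and `s` to the indices, where classes can be counted.
      _~_ : Rel (Fin q) c
      i ~ j = ∃ λ g → f (conj g (s i)) ≡ j

      ~-intro : ∀ {i j} g → conj g (s i) ≈ s j → i ~ j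
      ~-intro {j = j} g e = g , ≡.trans (f-cong e) (f∘s j)

      ~-elim : ∀ {i j} ((g , _) : i ~ j) → conj g (s i) ≈ s j
      ~-elim {j = j} (g , e) = f-inj (≡.trans e (≡.sym (f∘s j)))

      ~-isEquivalence : IsEquivalence _~_
      ~-isEquivalence = record
        { refl  = ~-intro ε (conj-ε _)
        ; sym   = λ r → ~-intro (proj₁ r ⁻¹)
            (≈-trans (conj-congˡ _ (≈-sym (~-elim r))) (conj-cancel′ _ _))
        ; trans = λ r t → ~-intro (proj₁ t ∙ proj₁ r)
            (≈-trans (conj-∙ _ _ _) (≈-trans (conj-congˡ _ (~-elim r)) (~-elim t)))
        }

      r : Fin q → Fin q
      r = proj₁ (representatives _~_ ~-isEquivalence)

      ~⇒≡ : ∀ {i j} → i ~ j → r i ≡ r j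
      ~⇒≡ = proj₁ (proj₂ (representatives _~_ ~-isEquivalence) _ _)

      ≡⇒~ : ∀ {i j} → r i ≡ r j → i ~ j
      ≡⇒~ = proj₂ (proj₂ (representatives _~_ ~-isEquivalence) _ _)

      -- Left translation by `g` permutes the indices. When `g` conjugates `s i` to `s j`, it
      -- matches the elements carrying `s i` to itself with those carrying it to `s j`.
      translation : Carrier → Permutation′ q
      translation g = permutation (λ i → f (g ∙ s i)) (λ i → f (g ⁻¹ ∙ s i))
        (λ i → ≡.trans (f-cong (≈-trans (∙-congˡ (s∘f _))
          (\\-leftDividesˡ g (s i)))) (f∘s i))
        (λ i → ≡.trans (f-cong (≈-trans (∙-congˡ (s∘f _))
          (\\-leftDividesʳ g (s i)))) (f∘s i))

      orbitMap : Carrier → Fin q → Fin q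
      orbitMap x i = f (conj (s i) x)

      -- The fibres of the orbit map are the cosets of the centraliser, hence all of one size.
      fibre-orbitMap : ∀ i j →
        fibre (orbitMap (s i)) j ≡ fibre (orbitMap (s i)) i * δ (r j) (r i)
      fibre-orbitMap i j with r j ≟ r i
      ... | no ¬e = ≡.trans (sum-zero (λ l → δ-≢ (λ e → ¬e (≡.sym (~⇒≡ (s l , e))))))
                      (≡.sym (*-zeroʳ (fibre (orbitMap (s i)) i)))
      ... | yes e = ≡.trans
        (≡.trans (sum-permute (λ l → δ (orbitMap (s i) l) j) (translation g))
          (sum-cong-≗ (λ l → δ-cong (to l) (from l))))
        (≡.sym (*-identityʳ _))
        where
        i~j = ≡⇒~ (≡.sym e)
        g = proj₁ i~j

        shift : ∀ l → conj (s (f (g ∙ s l))) (s i) ≈ conj g (conj (s l) (s i))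
        shift l = ≈-trans (conj-congʳ _ (s∘f _)) (conj-∙ _ _ _)

        to : ∀ l → orbitMap (s i) (translation g ⟨$⟩ʳ l) ≡ j → orbitMap (s i) l ≡ i
        to l e = ≡.trans (f-cong (conj-injective g (≈-trans (≈-sym (shift l))
          (≈-trans (f-inj (≡.trans e (≡.sym (f∘s j)))) (≈-sym (~-elim i~j)))))) (f∘s i)

        from : ∀ l → orbitMap (s i) l ≡ i → orbitMap (s i) (translation g ⟨$⟩ʳ l) ≡ j
        from l e = ≡.trans (f-cong (≈-trans (shift l) (≈-trans
          (conj-congˡ g (f-inj (≡.trans e (≡.sym (f∘s i))))) (~-elim i~j)))) (f∘s j)

      -- The first factor is the order of the centraliser of `s i`, the second the size of its
      -- conjugacy class; the product arises by summing `fibre-orbitMap` over `j`.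
      orbit-stabiliser : ∀ i → fibre (orbitMap (s i)) i * fibre r (r i) ≡ q
      orbit-stabiliser i = ≡.trans
        (≡.trans (*-distribˡ-sum (fibre (orbitMap (s i)) i) (λ j → δ (r j) (r i)))
          (≡.sym (sum-cong-≗ (fibre-orbitMap i))))
        (sum-fibre (orbitMap (s i)))

      fibre≡1⇒central : ∀ i → fibre r (r i) ≡ 1 → ∀ g → conj g (s i) ≈ s i
      fibre≡1⇒central i e g = f-inj (≡.trans
        (fibre≡1⇒unique {h = r} e ≡.refl (≡.sym (~⇒≡ (g , ≡.refl)))) (≡.sym (f∘s i)))

      -- A value not taken by `r` has an empty fibre. Otherwise the class size divides a power of
      -- `p`, and size one would make `s i` central, hence `ε`, contrary to the choice of `j`.
      p∣fibre : ∀ j → j ≢ r (f ε) → p ∣ fibre r j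
      p∣fibre j j≢ with any? (λ i → r i ≟ j)
      ... | no ¬∃ = ≡.subst (p ∣_) (≡.sym (sum-zero {t = λ i → δ (r i) j} (λ i → δ-≢ (λ e → ¬∃ (i , e))))) (p ∣0)
      ... | yes (i , ≡.refl) with ∣p^k⇒p∣⊎≡1 pp (suc k) {fibre (orbitMap (s i)) i} (orbit-stabiliser i)
      ...   | inj₁ p∣ = p∣
      ...   | inj₂ e  = contradiction
        (≡.cong r (≡.trans (≡.sym (f∘s i)) (f-cong (central⇒≈ε (s i) (fibre≡1⇒central i e))))) j≢

      fibre-ε : fibre r (r (f ε)) ≡ 1
      fibre-ε = ≡.trans (sum-single (f ε) (λ j j≢ → δ-≢ (λ e → j≢ (j≡fε (≡⇒~ (≡.sym e))))))
                  (δ-≡ {i = r (f ε)} ≡.refl)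
        where
        j≡fε : ∀ {j} → f ε ~ j → j ≡ f ε
        j≡fε {j} (g , e) = ≡.trans (≡.sym e) (f-cong (≈-trans (conj-congˡ g (s∘f ε)) (conj-homo-ε g)))

      p∣1 : p ∣ 1
      p∣1 = ≡.subst (p ∣_) fibre-ε (∣-sum⇒∣ (r (f ε)) p∣fibre
        (≡.subst (p ∣_) (≡.sym (sum-fibre r)) (m∣m*n (p ^ k))))

-- The tube lemma.

module _ {S T : Setoid c c} (X : Topology S) (Y : Topology T) where
  private
    module X = Topology X
    module Y = Topology Y

  -- Finitely many of the boxes on which `R` holds cover the slice over `y`; the intersection of
  -- their second sides is the required neighbourhood.
  tube : X.Compact → ∀ y (R : Setoid.Carrier S → Setoid.Carrier T → Set c) →
    (∀ x → ∃₂ λ i j → x ∈ X.Basic i × y ∈ Y.Basic j ×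
      (∀ {x′ y′} → x′ ∈ X.Basic i → y′ ∈ Y.Basic j → R x′ y′)) →
    ∃ λ k → y ∈ Y.Basic k × (∀ {y′} → y′ ∈ Y.Basic k → ∀ x → R x y′)
  tube compact y R local =
    let k , y∈k , on-k = meet (proj₁ cover) in k , y∈k , λ y′∈k x → on-k y′∈k (proj₂ cover x)
    where
    -- An index carries the whole box with its proof of `R`, so the finite subcover already lists
    -- the second sides to be intersected.
    I = ∃₂ λ i j → y ∈ Y.Basic j × (∀ {x′ y′} → x′ ∈ X.Basic i → y′ ∈ Y.Basic j → R x′ y′)

    cover : ∃ λ (is : List I) → ∀ x → Any (λ i → x ∈ X.Basic (proj₁ i)) is
    cover = compact (λ (i : I) → X.Basic (proj₁ i)) (λ (i , _) x∈i → i , x∈i , id)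
      (λ x → let i , j , x∈i , y∈j , r = local x in (i , j , y∈j , r) , x∈i)

    meet : (is : List I) → ∃ λ k → y ∈ Y.Basic k ×
      (∀ {y′} → y′ ∈ Y.Basic k → ∀ {x} → Any (λ i → x ∈ X.Basic (proj₁ i)) is → R x y′)
    meet [] = let k , y∈k = Y.Basic-covers y in k , y∈k , λ _ ()
    meet ((i , j , y∈j , r) ∷ is) =
      let k , y∈k , on-k = meet is
          l , y∈l , l⊆   = Y.Basic-refines j k (y∈j , y∈k)
      in l , y∈l , λ where
           y′∈l (here x∈i) → r x∈i (proj₁ (l⊆ y′∈l))
           y′∈l (there x∈) → on-k (proj₂ (l⊆ y′∈l)) x∈

-- Topological groups: generated subgroups, closures, cosets, quotients and indices.

module TopologicalGroupProperties (G : TopologicalGroup c) where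
  open TopologicalGroup G
  open GroupSolver group
  open GroupProperties group using (\\-leftDividesˡ)

  generated-least : {A : Pred Carrier a} {H : Pred Carrier b} → IsSubgroup H → A ⊆ H → Generated A ⊆ H
  generated-least H≤ A⊆H (gen x∈A)  = A⊆H x∈A
  generated-least H≤ A⊆H unit       = IsSubgroup.ε-closed H≤
  generated-least H≤ A⊆H (mul x y)  =
    IsSubgroup.∙-closed H≤ (generated-least H≤ A⊆H x) (generated-least H≤ A⊆H y)
  generated-least H≤ A⊆H (inv x)    = IsSubgroup.⁻¹-closed H≤ (generated-least H≤ A⊆H x)
  generated-least H≤ A⊆H (resp e x) = IsSubgroup.respects H≤ e (generated-least H≤ A⊆H x)

  generated-isSubgroup : (A : Pred Carrier a) → IsSubgroup (Generated A)
  generated-isSubgroup A = record { respects = resp ; ε-closed = unit ; ∙-closed = mul ; ⁻¹-closed = inv }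

  generated-normal : (A : Pred Carrier a) → (∀ g {x} → x ∈ A → conj g x ∈ A) → IsNormalSubgroup (Generated A)
  generated-normal A A-conj = record { isSubgroup = generated-isSubgroup A ; conj-closed = conj-closed′ }
    where
    conj-closed′ : ∀ g {x} → Generated A x → Generated A (conj g x)
    conj-closed′ g (gen x∈A) = gen (A-conj g x∈A)
    conj-closed′ g unit = resp (sym (conj-homo-ε g)) unit
    conj-closed′ g (mul {x} {y} p q) =
      resp (sym (conj-homo-∙ g x y)) (mul (conj-closed′ g p) (conj-closed′ g q))
    conj-closed′ g (inv {x} p) =
      resp (sym (conj-homo-⁻¹ g x)) (inv (conj-closed′ g p))
    conj-closed′ g (resp e p) = resp (conj-congˡ g e) (conj-closed′ g p)

  Commutators : Pred Carrier a → Pred Carrier b → Pred Carrier _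
  Commutators A B x = ∃₂ λ y z → y ∈ A × z ∈ B × x ≈ y ⁻¹ ∙ z ⁻¹ ∙ y ∙ z

  -- For a subgroup `H` this is its normal core, the intersection of all conjugates.
  Core : Pred Carrier ℓ → Pred Carrier _
  Core H x = ∀ g → conj g x ∈ H

  core-normal : {H : Pred Carrier ℓ} → IsSubgroup H → IsNormalSubgroup (Core H)
  core-normal H≤ = record
    { isSubgroup = record
      { respects  = λ e q g → respects (conj-congˡ g e) (q g)
      ; ε-closed  = λ g → respects (sym (conj-homo-ε g)) ε-closed
      ; ∙-closed  = λ {x} {y} q r g → respects (sym (conj-homo-∙ g x y)) (∙-closed (q g) (r g))
      ; ⁻¹-closed = λ {x} q g → respects (sym (conj-homo-⁻¹ g x)) (⁻¹-closed (q g))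
      }
    ; conj-closed = λ h {x} q g → respects (conj-∙ g h x) (q (g ∙ h))
    }
    where open IsSubgroup H≤

  closure-mono : {A : Pred Carrier a} {B : Pred Carrier b} → A ⊆ B → closure A ⊆ closure B
  closure-mono A⊆B x∈ i x∈i = let y , y∈i , y∈A = x∈ i x∈i in y , y∈i , A⊆B y∈A

  closure-respects : (A : Pred Carrier a) → ∀ {x y} → x ≈ y → x ∈ closure A → y ∈ closure A
  closure-respects A e x∈ i y∈i = x∈ i (Basic-respects i (sym e) y∈i)

  ⊆closure : {A : Pred Carrier a} → A ⊆ closure A
  ⊆closure x∈A i x∈i = _ , x∈i , x∈A

  closure-idem : (A : Pred Carrier a) → closure (closure A) ⊆ closure A
  closure-idem A x∈ i x∈i = let y , y∈i , y∈ = x∈ i x∈i in y∈ i y∈i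

  open-respects : {V : Pred Carrier ℓ} → Open V → ∀ {x y} → x ≈ y → x ∈ V → y ∈ V
  open-respects open-V e x∈V = let i , x∈i , i⊆V = open-V x∈V in i⊆V (Basic-respects i e x∈i)

  ∩-open : {V : Pred Carrier a} {W : Pred Carrier b} → Open V → Open W → Open (V ∩ W)
  ∩-open open-V open-W (x∈V , x∈W) =
    let i , x∈i , i⊆V = open-V x∈V
        j , x∈j , j⊆W = open-W x∈W
        k , x∈k , k⊆  = Basic-refines i j (x∈i , x∈j)
    in k , x∈k , λ y∈k → i⊆V (proj₁ (k⊆ y∈k)) , j⊆W (proj₂ (k⊆ y∈k))

  ∩-isSubgroup : {H : Pred Carrier a} {K : Pred Carrier b} → IsSubgroup H → IsSubgroup K → IsSubgroup (H ∩ K)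
  ∩-isSubgroup H≤ K≤ = record
    { respects  = λ e (x∈H , x∈K) → H.respects e x∈H , K.respects e x∈K
    ; ε-closed  = H.ε-closed , K.ε-closed
    ; ∙-closed  = λ (x∈H , x∈K) (y∈H , y∈K) → H.∙-closed x∈H y∈H , K.∙-closed x∈K y∈K
    ; ⁻¹-closed = λ (x∈H , x∈K) → H.⁻¹-closed x∈H , K.⁻¹-closed x∈K
    }
    where
    module H = IsSubgroup H≤
    module K = IsSubgroup K≤

  translate-open : {V : Pred Carrier c} → Open V → ∀ x → Open (λ y → x ∙ y ∈ V)
  translate-open open-V x xy∈V =
    let (i , j) , (x∈i , y∈j) , ij⊆V = ∙-continuous open-V xy∈V
    in j , y∈j , λ z∈j → ij⊆V (x∈i , z∈j)

  translateʳ-open : {V : Pred Carrier c} → Open V → ∀ y → Open (λ x → x ∙ y ∈ V)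
  translateʳ-open open-V y xy∈V =
    let (i , j) , (x∈i , y∈j) , ij⊆V = ∙-continuous open-V xy∈V
    in i , x∈i , λ z∈i → ij⊆V (z∈i , y∈j)

  conj-open : {V : Pred Carrier c} → Open V → ∀ g → Open (λ x → conj g x ∈ V)
  conj-open open-V g = translate-open (translateʳ-open open-V (g ⁻¹)) g

  module _ {H : Pred Carrier ℓ} (H≤ : IsSubgroup H) where
    open IsSubgroup H≤

    ≈⇒∼ : ∀ {x y} → x ≈ y → x ∼ y mod H
    ≈⇒∼ {x} e = respects (trans (sym (inverseˡ x)) (∙-congˡ e)) ε-closed

    ∼-sym : ∀ {x y} → x ∼ y mod H → y ∼ x mod H
    ∼-sym {x} {y} p = respects (solve 2 (λ x y → ⊖ (⊖ x ⊕ y) ⊜ ⊖ y ⊕ x) refl x y) (⁻¹-closed p)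

    ∼-trans : ∀ {x y z} → x ∼ y mod H → y ∼ z mod H → x ∼ z mod H
    ∼-trans {x} {y} {z} p q =
      respects (solve 3 (λ x y z → (⊖ x ⊕ y) ⊕ (⊖ y ⊕ z) ⊜ ⊖ x ⊕ z) refl x y z) (∙-closed p q)

    ε∼⇒∈ : ∀ {x} → ε ∼ x mod H → x ∈ H
    ε∼⇒∈ {x} = respects (solve 1 (λ x → ⊖ ∅ ⊕ x ⊜ x) refl x)

    ∼-resp-∈ : ∀ {x y} → x ∼ y mod H → x ∈ H → y ∈ H
    ∼-resp-∈ {x} {y} p x∈H = respects (\\-leftDividesˡ x y) (∙-closed x∈H p)

    -- Translating the neighbourhood of `ε` by a point `x` of `H` gives a neighbourhood of `x`
    -- inside the coset of `x`, which is `H`.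
    neighbourhood⇒open : ∀ {i} → ε ∈ Basic i → Basic i ⊆ H → Open H
    neighbourhood⇒open {i} ε∈i i⊆H {x} x∈H =
      let j , x∈j , j⊆ = translate-open (λ y∈i → i , y∈i , id) (x ⁻¹)
                           (Basic-respects i (sym (inverseˡ x)) ε∈i)
      in j , x∈j , λ y∈j → ∼-resp-∈ (i⊆H (j⊆ y∈j)) x∈H

    ⊇open⇒open : {N : Pred Carrier a} → Open N → ε ∈ N → N ⊆ H → Open H
    ⊇open⇒open open-N ε∈N N⊆H =
      let i , ε∈i , i⊆N = open-N ε∈N in neighbourhood⇒open ε∈i (N⊆H ∘ i⊆N)

  -- The coset of a point outside `N` is open and disjoint from `N`.
  open⇒closed : {N : Pred Carrier c} → IsSubgroup N → Open N → Closed N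
  open⇒closed N≤ open-N {x} x∉N =
    let i , x∈i , i⊆ = translate-open open-N (x ⁻¹) (≈⇒∼ N≤ refl)
    in i , x∈i , λ y∈i y∈N → x∉N (∼-resp-∈ N≤ (∼-sym N≤ (i⊆ y∈i)) y∈N)

  module _ {N : Pred Carrier ℓ} (N⊴ : IsNormalSubgroup N) where
    open IsNormalSubgroup N⊴
    open IsSubgroup isSubgroup

    ∼-∙-cong : ∀ {x x′ y y′} → x ∼ x′ mod N → y ∼ y′ mod N → (x ∙ y) ∼ (x′ ∙ y′) mod N
    ∼-∙-cong {x} {x′} {y} {y′} p q = respects
      (solve 4 (λ x x′ y y′ → (⊖ y ⊕ (⊖ x ⊕ x′) ⊕ ⊖ ⊖ y) ⊕ (⊖ y ⊕ y′) ⊜ ⊖ (x ⊕ y) ⊕ (x′ ⊕ y′)) refl x x′ y y′)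
      (∙-closed (conj-closed (y ⁻¹) p) q)

    ∼-⁻¹-cong : ∀ {x y} → x ∼ y mod N → (x ⁻¹) ∼ (y ⁻¹) mod N
    ∼-⁻¹-cong {x} {y} p = respects
      (solve 2 (λ x y → x ⊕ ⊖ (⊖ x ⊕ y) ⊕ ⊖ x ⊜ ⊖ ⊖ x ⊕ ⊖ y) refl x y)
      (conj-closed x (⁻¹-closed p))

    ∼-conj-cong : ∀ g {x y} → x ∼ y mod N → conj g x ∼ conj g y mod N
    ∼-conj-cong g p = ∼-∙-cong (∼-∙-cong (≈⇒∼ isSubgroup refl) p) (≈⇒∼ isSubgroup refl)

    -- The carrier is kept and only the equality is coarsened, so no coset representatives are
    -- chosen.
    quotient : Group c ℓ
    quotient = record
      { Carrier = Carrier
      ; _≈_     = λ x y → x ∼ y mod N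
      ; _∙_     = _∙_
      ; ε       = ε
      ; _⁻¹     = _⁻¹
      ; isGroup = record
        { isMonoid = record
          { isSemigroup = record
            { isMagma = record
              { isEquivalence = record
                { refl  = ≈⇒∼ isSubgroup refl
                ; sym   = ∼-sym isSubgroup
                ; trans = ∼-trans isSubgroup
                }
              ; ∙-cong = ∼-∙-cong
              }
            ; assoc = λ x y z → ≈⇒∼ isSubgroup (assoc x y z)
            }
          ; identity = (λ x → ≈⇒∼ isSubgroup (identityˡ x)) , (λ x → ≈⇒∼ isSubgroup (identityʳ x))
          }
        ; inverse = (λ x → ≈⇒∼ isSubgroup (inverseˡ x)) , (λ x → ≈⇒∼ isSubgroup (inverseʳ x))
        ; ⁻¹-cong = ∼-⁻¹-cong
        }
      }

    -- The preimage in the group of the centre of the quotient by `N`.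
    CentralMod : Pred Carrier _
    CentralMod x = ∀ g → conj g x ∼ x mod N

    centralMod-normal : IsNormalSubgroup CentralMod
    centralMod-normal = record
      { isSubgroup = record
        { respects  = λ e p g → ~trans (≈⇒~ (conj-congˡ g (sym e))) (~trans (p g) (≈⇒~ e))
        ; ε-closed  = λ g → ≈⇒~ (conj-homo-ε g)
        ; ∙-closed  = λ {x} {y} p q g → ~trans
            (≈⇒~ (conj-homo-∙ g x y)) (∼-∙-cong (p g) (q g))
        ; ⁻¹-closed = λ {x} p g → ~trans
            (≈⇒~ (conj-homo-⁻¹ g x)) (∼-⁻¹-cong (p g))
        }
      ; conj-closed = λ h {x} p g → ~trans (≈⇒~ (sym (conj-∙ g h x)))
          (~trans (p (g ∙ h)) (∼-sym isSubgroup (p h)))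
      }
      where
      ≈⇒~ : ∀ {x y} → x ≈ y → x ∼ y mod N
      ≈⇒~ = ≈⇒∼ isSubgroup
      ~trans : ∀ {x y z} → x ∼ y mod N → y ∼ z mod N → x ∼ z mod N
      ~trans = ∼-trans isSubgroup

    ⊆centralMod : N ⊆ CentralMod
    ⊆centralMod x∈N g = ∙-closed (⁻¹-closed (conj-closed g x∈N)) x∈N

  -- This makes the index a decreasing measure when an open normal subgroup is enlarged to the
  -- preimage of the centre. The strict inequality comes from `suc n` elements pairwise incongruent
  -- modulo `H`.
  hasIndex-strict : {H : Pred Carrier a} {K : Pred Carrier b} → IsSubgroup H → IsSubgroup K → H ⊆ K →
    ∀ {z} → z ∈ K → z ∉ H → ∀ {m n} → HasIndex H m → HasIndex K n → n < m
  hasIndex-strict {H = H} {K} H≤ K≤ H⊆K {z} z∈K z∉H {m} {n} (f , _ , f-inj , _) (g , g-cong , _ , g-surj) =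
    injective⇒≤ F-injective
    where
    s : Fin n → Carrier
    s j = proj₁ (g-surj j)

    s-injective : ∀ {i j} → s i ∼ s j mod K → i ≡ j
    s-injective {i} {j} e = ≡.trans (≡.sym (g∘s i)) (≡.trans (g-cong e) (g∘s j))
      where
      g∘s : ∀ i → g (s i) ≡ i
      g∘s i = proj₂ (g-surj i) (≈⇒∼ K≤ refl)

    x₀ : Carrier
    x₀ = s (g ε)

    -- x₀ ∙ z lies in the K-coset of x₀ but not in its H-coset, so it adds one H-coset to
    -- those of the representatives of the K-cosets.
    F : Fin (suc n) → Fin m
    F zero    = f (x₀ ∙ z)
    F (suc j) = f (s j)

    x₀z≁s : ∀ j → ¬ ((x₀ ∙ z) ∼ s j mod H)
    x₀z≁s j e with s-injective {g ε} {j} (∼-trans K≤ x₀∼x₀z (H⊆K e))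
      where
      x₀∼x₀z : x₀ ∼ (x₀ ∙ z) mod K
      x₀∼x₀z = IsSubgroup.respects K≤ (solve 2 (λ x z → z ⊜ ⊖ x ⊕ (x ⊕ z)) refl x₀ z) z∈K
    ... | ≡.refl = z∉H (IsSubgroup.respects H≤
      (solve 2 (λ x z → ⊖ (⊖ (x ⊕ z) ⊕ x) ⊜ z) refl x₀ z) (IsSubgroup.⁻¹-closed H≤ e))

    F-injective : Injective _≡_ _≡_ F
    F-injective {zero}  {zero}  e = ≡.refl
    F-injective {zero}  {suc j} e = contradiction (f-inj e) (x₀z≁s j)
    F-injective {suc j} {zero}  e = contradiction (f-inj (≡.sym e)) (x₀z≁s j)
    F-injective {suc i} {suc j} e = ≡.cong suc (s-injective (H⊆K (f-inj e)))

  pow-cong : ∀ n {x y} → x ≈ y → pow n x ≈ pow n y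
  pow-cong zero    e = refl
  pow-cong (suc n) e = ∙-cong e (pow-cong n e)

  pow-conj : ∀ n g x → conj g (pow n x) ≈ pow n (conj g x)
  pow-conj zero    g x = conj-homo-ε g
  pow-conj (suc n) g x = trans (conj-homo-∙ g x (pow n x)) (∙-congˡ (pow-conj n g x))

-- Pro-p groups: approximation modulo open normal subgroups, and the induction on the index.

module ProPGroupProperties {p : ℕ} (G : ProPGroup p c) where
  open ProPGroup G
  open IsProP isProP
  open TopologicalGroupProperties topologicalGroup public
  open GroupSolver group
  open GroupProperties group using (\\-leftDividesˡ)

  -- Every `g` conjugates `ε` into `H`. By the tube lemma one neighbourhood of `ε` is conjugated
  -- into `H` by all `g` at once.
  core-open : {H : Pred Carrier c} → IsSubgroup H → Open H → Open (Core H)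
  core-open {H} H≤ open-H =
    let k , ε∈k , k⊆ = tube topology topology compact ε (λ g x → conj g x ∈ H) local
    in neighbourhood⇒open (IsNormalSubgroup.isSubgroup (core-normal H≤)) ε∈k (λ x∈k → k⊆ x∈k)
    where
    open IsSubgroup H≤

    local : ∀ g → ∃₂ λ i j → g ∈ Basic i × ε ∈ Basic j ×
      (∀ {g′ x} → g′ ∈ Basic i → x ∈ Basic j → conj g′ x ∈ H)
    local g =
      -- Joint continuity of conjugation is unwound as two multiplications and one inversion.
      let (i , j) , (gε∈i , g⁻¹∈j) , ij⊆H = ∙-continuous open-H {g ∙ ε , g ⁻¹}
            (respects (sym (conj-homo-ε g)) ε-closed)
          (k , l) , (g∈k , ε∈l) , kl⊆i = ∙-continuous (λ x∈i → i , x∈i , id) {g , ε} gε∈i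
          m , g∈m , m⊆j = ⁻¹-continuous (λ x∈j → j , x∈j , id) g⁻¹∈j
          n , g∈n , n⊆km = Basic-refines k m (g∈k , g∈m)
      in n , l , g∈n , ε∈l , λ g′∈n x∈l →
           ij⊆H (kl⊆i (proj₁ (n⊆km g′∈n) , x∈l) , m⊆j (proj₂ (n⊆km g′∈n)))

  open-normal-base : ∀ {i} → ε ∈ Basic i →
    ∃ λ (N : Pred Carrier c) → IsNormalSubgroup N × Open N × N ⊆ Basic i
  open-normal-base {i} ε∈i =
    let H , H≤ , open-H , H⊆i = open-subgroups (λ x∈i → i , x∈i , id) ε∈i
    in Core H
     , core-normal H≤
     , core-open H≤ open-H
     , λ {x} q → H⊆i (IsSubgroup.respects H≤ (conj-ε x) (q ε))

  -- The coset of `x` is a neighbourhood of `x`, so it meets `A`. With the converse `∼⇒closure`,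
  -- arguments about closures become computations modulo open normal subgroups.
  closure⇒∼ : {A : Pred Carrier a} {N : Pred Carrier c} → IsSubgroup N → Open N →
    ∀ {x} → x ∈ closure A → ∃ λ y → y ∈ A × x ∼ y mod N
  closure⇒∼ N≤ open-N {x} x∈ =
    let i , x∈i , i⊆ = translate-open open-N (x ⁻¹) (≈⇒∼ N≤ refl)
        y , y∈i , y∈A = x∈ i x∈i
    in y , y∈A , i⊆ y∈i

  -- The translates to `x` of the open normal subgroups are arbitrarily small neighbourhoods of `x`.
  ∼⇒closure : {A : Pred Carrier a} → ∀ {x} →
    ({N : Pred Carrier c} → IsNormalSubgroup N → Open N → ∃ λ y → y ∈ A × x ∼ y mod N) → x ∈ closure A
  ∼⇒closure {A = A} {x} approx i x∈i = near (open-normal-base (proj₁ (proj₂ nbhd)))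
    where
    nbhd : ∃ λ j → ε ∈ Basic j × (∀ {y} → y ∈ Basic j → x ∙ y ∈ Basic i)
    nbhd = translate-open (λ y∈i → i , y∈i , id) x (Basic-respects i (sym (identityʳ x)) x∈i)

    near : (∃ λ (N : Pred Carrier c) → IsNormalSubgroup N × Open N × N ⊆ Basic (proj₁ nbhd)) →
           ∃ λ y → y ∈ Basic i × y ∈ A
    near (N , N⊴ , open-N , N⊆) =
      let y , y∈A , x∼y = approx N⊴ open-N
      in y , Basic-respects i (\\-leftDividesˡ x y) (proj₂ (proj₂ nbhd) (N⊆ x∼y)) , y∈A

  closure-open-subgroup : {N : Pred Carrier c} → IsSubgroup N → Open N → closure N ⊆ N
  closure-open-subgroup N≤ open-N x∈ =
    let y , y∈N , x∼y = closure⇒∼ N≤ open-N x∈ in ∼-resp-∈ N≤ (∼-sym N≤ x∼y) y∈N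

  ⟪⟫-least-open : {A : Pred Carrier a} {N : Pred Carrier c} → IsSubgroup N → Open N → A ⊆ N → ⟪ A ⟫ ⊆ N
  ⟪⟫-least-open N≤ open-N A⊆N x∈ =
    closure-open-subgroup N≤ open-N (closure-mono (generated-least N≤ A⊆N) x∈)

  closure-isSubgroup : {A : Pred Carrier a} → IsSubgroup A → IsSubgroup (closure A)
  closure-isSubgroup {A = A} A≤ = record
    { respects  = closure-respects A
    ; ε-closed  = ⊆closure ε-closed
    ; ∙-closed  = λ x∈ y∈ → ∼⇒closure λ N⊴ open-N →
        let N≤ = IsNormalSubgroup.isSubgroup N⊴
            x′ , x′∈ , x∼ = closure⇒∼ N≤ open-N x∈
            y′ , y′∈ , y∼ = closure⇒∼ N≤ open-N y∈
        in x′ ∙ y′ , ∙-closed x′∈ y′∈ , ∼-∙-cong N⊴ x∼ y∼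
    ; ⁻¹-closed = λ x∈ → ∼⇒closure λ N⊴ open-N →
        let x′ , x′∈ , x∼ = closure⇒∼ (IsNormalSubgroup.isSubgroup N⊴) open-N x∈
        in x′ ⁻¹ , ⁻¹-closed x′∈ , ∼-⁻¹-cong N⊴ x∼
    }
    where open IsSubgroup A≤

  closure-normal : {A : Pred Carrier a} → IsNormalSubgroup A → IsNormalSubgroup (closure A)
  closure-normal A⊴ = record
    { isSubgroup  = closure-isSubgroup isSubgroup
    ; conj-closed = λ g x∈ → ∼⇒closure λ N⊴ open-N →
        let x′ , x′∈ , x∼ = closure⇒∼ (IsNormalSubgroup.isSubgroup N⊴) open-N x∈
        in conj g x′ , conj-closed g x′∈ , ∼-conj-cong N⊴ g x∼
    }
    where open IsNormalSubgroup A⊴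

  ⟪⟫-isSubgroup : (A : Pred Carrier a) → IsSubgroup ⟪ A ⟫
  ⟪⟫-isSubgroup A = closure-isSubgroup (generated-isSubgroup A)

  ⟪⟫-least : {A : Pred Carrier a} {B : Pred Carrier b} → A ⊆ ⟪ B ⟫ → ⟪ A ⟫ ⊆ ⟪ B ⟫
  ⟪⟫-least {B = B} A⊆ x∈ = closure-idem _ (closure-mono (generated-least (⟪⟫-isSubgroup B) A⊆) x∈)

  ⊆·⟪⟫ : (A : Pred Carrier a) (B : Pred Carrier b) → A ⊆ A · ⟪ B ⟫
  ⊆·⟪⟫ A B {x} x∈A = x , ε , x∈A , IsSubgroup.ε-closed (⟪⟫-isSubgroup B) , sym (identityʳ x)

  ·-respects : {A : Pred Carrier a} {B : Pred Carrier b} → ∀ {x y} → x ≈ y → x ∈ A · B → y ∈ A · B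
  ·-respects e (y , z , y∈A , z∈B , f) = y , z , y∈A , z∈B , trans (sym e) f

  Powers : Pred Carrier ℓ → Pred Carrier _
  Powers H x = ∃ λ y → y ∈ H × x ≈ pow p y

  powers-conj : {H : Pred Carrier ℓ} → IsNormalSubgroup H → ∀ g {x} → x ∈ Powers H → conj g x ∈ Powers H
  powers-conj H⊴ g (y , y∈H , e) = conj g y , IsNormalSubgroup.conj-closed H⊴ g y∈H
    , trans (conj-congˡ g e) (pow-conj p g y)

  ℧₁-normal : {H : Pred Carrier ℓ} → IsNormalSubgroup H → IsNormalSubgroup (℧₁ p H)
  ℧₁-normal H⊴ = closure-normal (generated-normal _ (powers-conj H⊴))

  ℧₁⊆Fr : (H : Pred Carrier ℓ) → ℧₁ p H ⊆ Fr p H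
  ℧₁⊆Fr H = ⊆·⟪⟫ _ _

  -- The commutator of `g` and `w` is a conjugate of `w ⁻¹` times `w`, and both factors lie in the
  -- normal subgroup.
  [U,]⊆ : {M : Pred Carrier a} {N : Pred Carrier b} → IsNormalSubgroup ⟪ N ⟫ → M ⊆ ⟪ N ⟫ → [ U , M ] ⊆ ⟪ N ⟫
  [U,]⊆ N⊴ M⊆ = ⟪⟫-least λ (g , w , _ , w∈M , e) → respects
    (trans (solve 2 (λ g w → ⊖ g ⊕ ⊖ w ⊕ ⊖ ⊖ g ⊕ w ⊜ ⊖ g ⊕ ⊖ w ⊕ g ⊕ w) refl g w) (sym e))
    (∙-closed (conj-closed (g ⁻¹) (⁻¹-closed (M⊆ w∈M))) (M⊆ w∈M))
    where
    open IsNormalSubgroup N⊴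
    open IsSubgroup isSubgroup

  module _ (em : ∀ {ℓ} → ExcludedMiddle ℓ) (pp : Prime p) where

    -- Induction on the index of `P`, with a numerical bound as fuel. The preimage of the centre of
    -- the quotient by `P` has smaller index, so it contains `M`; then `[ U , M ]` lies in `P`, and
    -- the hypothesis on `M` gives the claim.
    ⊆·[U,]⇒⊆ : (K : Pred Carrier a) (M : Pred Carrier b) → M ⊆ K · [ U , M ] →
      {P : Pred Carrier c} → IsNormalSubgroup P → Open P → K ⊆ P → M ⊆ P
    ⊆·[U,]⇒⊆ K M M⊆ P⊴ open-P K⊆P =
      let _ , index = index-power-of-p P⊴ open-P in go _ ≤-refl P⊴ open-P K⊆P index
      where
      go : ∀ bound {m} → m ≤ bound → {P : Pred Carrier c} → IsNormalSubgroup P → Open P → K ⊆ P →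
           HasIndex P m → M ⊆ P
      go zero    z≤n P⊴ open-P K⊆P (f , _) {x} x∈M with () ← f x
      go (suc bound) m≤ {P} P⊴ open-P K⊆P index {x} x∈M
        -- The number `m` measures the descent but is not known here to be a power of `p`; an
        -- enumeration by a power is obtained separately for the class equation.
        with index-power-of-p P⊴ open-P
      -- Exponent zero means index one, so every element is congruent to `ε`.
      ... | zero , f , _ , f-inj , _ = ε∼⇒∈ P≤ (f-inj (fin1 (f ε) (f x)))
        where
        P≤ = IsNormalSubgroup.isSubgroup P⊴
        fin1 : (i j : Fin 1) → i ≡ j
        fin1 zero zero = ≡.refl
      ... | suc k , f , f-cong , f-bij =
        let z , z≁ε , z-central = centre-nontrivial em pp {k} (quotient P⊴) f f-cong f-bij
            l , Z-index = index-power-of-p Z⊴ open-Z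
            smaller = hasIndex-strict P≤ (IsNormalSubgroup.isSubgroup Z⊴) (⊆centralMod P⊴)
                        z-central (λ z∈P → z≁ε (∼-sym P≤ (P-respects (solve 1 (λ z → z ⊜ ⊖ ∅ ⊕ z) refl z) z∈P)))
                        index Z-index
            M⊆Z = go bound (≤-pred (≤-trans smaller m≤)) Z⊴ open-Z (⊆centralMod P⊴ ∘ K⊆P) Z-index
            y , w , y∈K , w∈ , e = M⊆ x∈M
        in P-respects (sym e) (P-∙-closed (K⊆P y∈K) ([U,]⊆P M⊆Z w∈))
        where
        P≤ = IsNormalSubgroup.isSubgroup P⊴
        open IsSubgroup P≤ renaming (respects to P-respects; ∙-closed to P-∙-closed; ε-closed to P-ε-closed)
        Z⊴ = centralMod-normal P⊴
        open-Z : Open (CentralMod P⊴)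
        open-Z = ⊇open⇒open (IsNormalSubgroup.isSubgroup Z⊴) open-P P-ε-closed (⊆centralMod P⊴)
        [U,]⊆P : M ⊆ CentralMod P⊴ → [ U , M ] ⊆ P
        -- Centrality of `w` modulo `P`, tested on `g ⁻¹`, says precisely that the commutator of `g`
        -- and `w` lies in `P`.
        [U,]⊆P M⊆Z = ⟪⟫-least-open P≤ open-P λ (g , w , _ , w∈M , e) → P-respects
          (trans (solve 2 (λ g w → ⊖ (⊖ g ⊕ w ⊕ ⊖ ⊖ g) ⊕ w ⊜ ⊖ g ⊕ ⊖ w ⊕ g ⊕ w) refl g w) (sym e))
          (M⊆Z w∈M (g ⁻¹))

    -- Since `℧₁ p H` is a closure, membership is tested modulo each open normal `N`. The previous
    -- lemma is applied to the product `KN` of `N` with the abstract group of p-th powers;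
    -- membership in `KN` is exactly the approximation required.
    Fr⊆℧₁ : {H : Pred Carrier c} → IsNormalSubgroup H → Fr p H ⊆ ℧₁ p H · [ U , Fr p H ] → Fr p H ⊆ ℧₁ p H
    Fr⊆℧₁ {H} H⊴ Fr⊆ {x} x∈Fr = ∼⇒closure λ {N} N⊴ open-N →
      let K⊴ = generated-normal _ (powers-conj H⊴)
          open IsNormalSubgroup N⊴ renaming (isSubgroup to N≤)
          KN : Pred Carrier c
          KN x = ∃ λ y → y ∈ Generated (Powers H) × x ∼ y mod N
          KN≤ : IsSubgroup KN
          KN≤ = record
            { respects  = λ { e (y , y∈ , x∼y) → y , y∈ , ∼-trans N≤ (≈⇒∼ N≤ (sym e)) x∼y }
            ; ε-closed  = ε , unit , ≈⇒∼ N≤ refl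
            ; ∙-closed  = λ { (x , x∈ , e) (y , y∈ , f) → x ∙ y , mul x∈ y∈ , ∼-∙-cong N⊴ e f }
            ; ⁻¹-closed = λ { (x , x∈ , e) → x ⁻¹ , inv x∈ , ∼-⁻¹-cong N⊴ e }
            }
          KN⊴ : IsNormalSubgroup KN
          KN⊴ = record
            { isSubgroup  = KN≤
            ; conj-closed = λ { g (x , x∈ , e) →
                conj g x , IsNormalSubgroup.conj-closed K⊴ g x∈ , ∼-conj-cong N⊴ g e }
            }
          N⊆KN : N ⊆ KN
          N⊆KN {x} x∈N = ε , unit , IsSubgroup.respects N≤ (sym (identityʳ _)) (IsSubgroup.⁻¹-closed N≤ x∈N)
      in ⊆·[U,]⇒⊆ (℧₁ p H) (Fr p H) Fr⊆ KN⊴ (⊇open⇒open KN≤ open-N (IsSubgroup.ε-closed N≤) N⊆KN)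
           (closure⇒∼ N≤ open-N) x∈Fr

-- Finite generation of open normal subgroups by Schreier's lemma.

module _ {p : ℕ} (G : ProPGroup p c) where
  open ProPGroup G
  open IsProP isProP
  open ProPGroupProperties G
  open GroupSolver group
  open GroupProperties group using (inverseˡ-unique)

  -- The generators of `G` generate a dense abstract subgroup `Γ`. The `q * k` Schreier elements
  -- generate a group containing `Γ` intersected with `H`, which is dense in `H` because `H` is
  -- open.
  schreier : {H : Pred Carrier c} → IsNormalSubgroup H → Open H →
    ∀ {k} → GeneratedBy k U → ∃ λ l → GeneratedBy l H
  schreier {H} H⊴ open-H {k} (y , _ , U⊆) = q * k , σ ∘ remQuot k , to , from
    where
    open IsNormalSubgroup H⊴ renaming (isSubgroup to H≤)
    open IsSubgroup H≤

    index = index-power-of-p H⊴ open-H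
    q = p ^ proj₁ index
    f = proj₁ (proj₂ index)
    f-cong = proj₁ (proj₂ (proj₂ index))
    f-inj = proj₁ (proj₂ (proj₂ (proj₂ index)))
    f-surj = proj₂ (proj₂ (proj₂ (proj₂ index)))

    Γ = Generated (λ g → ∃ λ i → g ≈ y i)

    transversal : ∀ j → ∃ λ t → t ∈ Γ × f t ≡ j × (j ≡ f ε → t ≈ ε)
    transversal j with j ≟ f ε
    ... | yes j≡ = ε , unit , ≡.sym j≡ , λ _ → refl
    ... | no j≢  =
      let t , t∈Γ , s∼t = closure⇒∼ H≤ open-H (U⊆ {proj₁ (f-surj j)} tt)
      in t , t∈Γ , ≡.trans (≡.sym (f-cong s∼t)) (proj₂ (f-surj j) (≈⇒∼ H≤ refl)) , λ j≡ → contradiction j≡ j≢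

    t : Fin q → Carrier
    t j = proj₁ (transversal j)

    f∘t : ∀ j → f (t j) ≡ j
    f∘t j = proj₁ (proj₂ (proj₂ (transversal j)))

    t∼ : ∀ x → t (f x) ∼ x mod H
    t∼ x = f-inj (f∘t (f x))

    t∘f-H : ∀ {x} → x ∈ H → t (f x) ≈ ε
    t∘f-H {x} x∈H = proj₂ (proj₂ (proj₂ (transversal (f x))))
      (f-cong (respects (sym (identityʳ _)) (⁻¹-closed x∈H)))

    -- t j ∙ x is τ j x times the chosen representative of its coset, so τ j x lies in H. τ is a cocycle
    -- for the action of G on the cosets, so on Γ it takes values in the subgroup generated by the
    -- σ (j , i); and τ (f ε) x ≈ x for x in H, thanks to the normalisation t (f ε) ≈ ε.
    τ : Fin q → Carrier → Carrier
    τ j x = t j ∙ x ∙ t (f (t j ∙ x)) ⁻¹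

    σ : Fin q × Fin k → Carrier
    σ (j , i) = τ j (y i)

    Σ-gens : Pred Carrier c
    Σ-gens g = ∃ λ i → g ≈ σ (remQuot k i)

    τ∈H : ∀ j x → τ j x ∈ H
    τ∈H j x = respects
      (solve 2 (λ x w → w ⊕ (⊖ w ⊕ x) ⊕ ⊖ w ⊜ x ⊕ ⊖ w) refl (t j ∙ x) (t (f (t j ∙ x))))
      (conj-closed (t (f (t j ∙ x))) (t∼ (t j ∙ x)))

    τ-cong : ∀ j {x x′} → x ≈ x′ → τ j x ≈ τ j x′
    τ-cong j {x} {x′} e = ∙-cong (∙-congˡ e)
      (reflexive (≡.cong (λ l → t l ⁻¹) (f-cong (≈⇒∼ H≤ (∙-congˡ e)))))

    -- Moving the coset `j` by `x` and then by `x′` is moving it by the product: the action on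
    -- cosets behind the cocycle rule.
    next : ∀ j x x′ → f (t (f (t j ∙ x)) ∙ x′) ≡ f (t j ∙ (x ∙ x′))
    next j x x′ = f-cong (∼-trans H≤ (∼-∙-cong H⊴ (t∼ (t j ∙ x)) (≈⇒∼ H≤ refl)) (≈⇒∼ H≤ (assoc _ _ _)))

    τ-∙ : ∀ j x x′ → τ j (x ∙ x′) ≈ τ j x ∙ τ (f (t j ∙ x)) x′
    τ-∙ j x x′ = trans
      (∙-congˡ (reflexive (≡.cong (λ l → t l ⁻¹) (≡.sym (next j x x′)))))
      (solve 5 (λ a x x′ b w → a ⊕ (x ⊕ x′) ⊕ ⊖ w ⊜ (a ⊕ x ⊕ ⊖ b) ⊕ (b ⊕ x′ ⊕ ⊖ w)) refl
        (t j) x x′ (t (f (t j ∙ x))) (t (f (t (f (t j ∙ x)) ∙ x′))))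

    τ-ε : ∀ j → τ j ε ≈ ε
    τ-ε j = trans
      (∙-congˡ (reflexive (≡.cong (λ l → t l ⁻¹)
        (≡.trans (f-cong (≈⇒∼ H≤ (identityʳ _))) (f∘t j)))))
      (solve 1 (λ a → a ⊕ ∅ ⊕ ⊖ a ⊜ ∅) refl (t j))

    τ-⁻¹ : ∀ j x → τ (f (t j ∙ x ⁻¹)) x ⁻¹ ≈ τ j (x ⁻¹)
    τ-⁻¹ j x = sym (inverseˡ-unique _ _ (trans (sym (τ-∙ j (x ⁻¹) x)) (trans (τ-cong j (inverseˡ x)) (τ-ε j))))

    τ-generated : ∀ {x} → x ∈ Γ → ∀ j → Generated Σ-gens (τ j x)
    τ-generated (gen (i , e)) j = gen (combine j i , trans (τ-cong j e)
      (reflexive (≡.cong σ (≡.sym (remQuot-combine j i)))))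
    τ-generated unit j = resp (sym (τ-ε j)) unit
    τ-generated (mul {x} {x′} x∈ x′∈) j = resp (sym (τ-∙ j x x′))
      (mul (τ-generated x∈ j) (τ-generated x′∈ (f (t j ∙ x))))
    τ-generated (inv {x} x∈) j = resp (τ-⁻¹ j x) (inv (τ-generated x∈ (f (t j ∙ x ⁻¹))))
    τ-generated (resp e x∈) j = resp (τ-cong j e) (τ-generated x∈ j)

    H∩Γ⊆ : ∀ {x} → x ∈ H → x ∈ Γ → Generated Σ-gens x
    H∩Γ⊆ {x} x∈H x∈Γ = resp
      (trans (∙-cong (trans (∙-congʳ t≈ε) (identityˡ x)) (⁻¹-cong (t∘f-H tx∈H)))
        (solve 1 (λ x → x ⊕ ⊖ ∅ ⊜ x) refl x))
      (τ-generated x∈Γ (f ε))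
      where
      t≈ε : t (f ε) ≈ ε
      t≈ε = t∘f-H ε-closed
      tx∈H : t (f ε) ∙ x ∈ H
      tx∈H = respects (sym (trans (∙-congʳ t≈ε) (identityˡ x))) x∈H

    to : ⟪ Σ-gens ⟫ ⊆ H
    to = ⟪⟫-least-open H≤ open-H λ (i , e) →
      respects (sym e) (let j , l = remQuot k i in τ∈H j (y l))

    from : H ⊆ ⟪ Σ-gens ⟫
    from {x} x∈H = ∼⇒closure λ {N} N⊴ open-N →
      let N≤ = IsNormalSubgroup.isSubgroup N⊴
          -- Approximating modulo `N` and `H` together keeps the approximant `w` inside `H`.
          w , w∈Γ , w∈N , w∈H = closure⇒∼ (∩-isSubgroup N≤ H≤) (∩-open open-N open-H) (U⊆ {x} tt)
      in w , H∩Γ⊆ (∼-resp-∈ H≤ w∈H x∈H) w∈Γ , w∈N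

  -- Inner automorphisms, and normality of characteristic subgroups.

  inner : Carrier → Aut G
  inner g = record
    { to      = conjHom g
    ; from    = conjHom (g ⁻¹)
    ; to∘from = conj-cancel g
    ; from∘to = conj-cancel′ g
    }
    where
    conjHom : Carrier → Hom G G
    conjHom g = record
      { ⟦_⟧            = conj g
      ; isHomomorphism = record
        { isMonoidHomomorphism = record
          { isMagmaHomomorphism = record
            { isRelHomomorphism = record { cong = conj-congˡ g }
            ; homo              = conj-homo-∙ g
            }
          ; ε-homo = conj-homo-ε g
          }
        ; ⁻¹-homo = conj-homo-⁻¹ g
        }
      ; continuous = λ open-V → conj-open open-V g
      }

  characteristic⇒normal : {E : Pred Carrier ℓ} → IsSubgroup E → IsCharacteristic G E → IsNormalSubgroup E
  characteristic⇒normal E≤ E-char = record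
    { isSubgroup  = E≤
    ; conj-closed = λ g x∈E → proj₁ (E-char (inner g)) (_ , x∈E , refl)
    }

-- Images of subgroups, closures and verbal constructions under a homomorphism.

module _ {p : ℕ} {F G : ProPGroup p c} (φ : Hom F G) where
  private
    module F where
      open ProPGroup F public
      open IsProP isProP public
      open ProPGroupProperties F public
    module G where
      open ProPGroup G public
      open IsProP isProP public
      open ProPGroupProperties G public
  open Hom φ
  open IsGroupHomomorphism isHomomorphism using (homo; ε-homo; ⁻¹-homo; ⟦⟧-cong)

  preimage-isSubgroup : {H : Pred G.Carrier ℓ} → G.IsSubgroup H → F.IsSubgroup (⟦_⟧ ⊢ H)
  preimage-isSubgroup H≤ = record
    { respects  = λ e → respects (⟦⟧-cong e)
    ; ε-closed  = respects (G.sym ε-homo) ε-closed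
    ; ∙-closed  = λ x∈ y∈ → respects (G.sym (homo _ _)) (∙-closed x∈ y∈)
    ; ⁻¹-closed = λ x∈ → respects (G.sym (⁻¹-homo _)) (⁻¹-closed x∈)
    }
    where open G.IsSubgroup H≤

  image-isSubgroup : {H : Pred F.Carrier ℓ} → F.IsSubgroup H → G.IsSubgroup (image H)
  image-isSubgroup H≤ = record
    { respects  = λ e (x , x∈ , f) → x , x∈ , G.trans f e
    ; ε-closed  = F.ε , ε-closed , ε-homo
    ; ∙-closed  = λ (x , x∈ , e) (y , y∈ , f) →
        x F.∙ y , ∙-closed x∈ y∈ , G.trans (homo x y) (G.∙-cong e f)
    ; ⁻¹-closed = λ (x , x∈ , e) → x F.⁻¹ , ⁻¹-closed x∈ , G.trans (⁻¹-homo x) (G.⁻¹-cong e)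
    }
    where open F.IsSubgroup H≤

  image-normal : IsSurjective → {H : Pred F.Carrier ℓ} → F.IsNormalSubgroup H → G.IsNormalSubgroup (image H)
  image-normal φ-surj H⊴ = record
    { isSubgroup  = image-isSubgroup isSubgroup
    ; conj-closed = λ g (x , x∈ , e) →
        let h , ⟦h⟧ = φ-surj g
        in h F.∙ x F.∙ h F.⁻¹ , conj-closed h x∈ , G.trans (homo _ _) (G.∙-cong
             (G.trans (homo _ _) (G.∙-cong (⟦h⟧ F.refl) e))
             (G.trans (⁻¹-homo _) (G.⁻¹-cong (⟦h⟧ F.refl))))
    }
    where open F.IsNormalSubgroup H⊴

  pow-homo : ∀ n x → ⟦ F.pow n x ⟧ G.≈ G.pow n ⟦ x ⟧
  pow-homo zero    x = ε-homo
  pow-homo (suc n) x = G.trans (homo _ _) (G.∙-congˡ (pow-homo n x))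

  commutator-homo : ∀ x y → ⟦ x F.⁻¹ F.∙ y F.⁻¹ F.∙ x F.∙ y ⟧ G.≈ ⟦ x ⟧ G.⁻¹ G.∙ ⟦ y ⟧ G.⁻¹ G.∙ ⟦ x ⟧ G.∙ ⟦ y ⟧
  commutator-homo x y = G.trans (homo _ _) (G.∙-congʳ (G.trans (homo _ _) (G.∙-congʳ
    (G.trans (homo _ _) (G.∙-cong (⁻¹-homo x) (⁻¹-homo y))))))

  -- As a pair of inclusions the relation passes through products, commutators and closures without
  -- asking that the target respect equality; `onto⇒image≐` adds that at the end.
  Maps_onto_ : Pred F.Carrier a → Pred G.Carrier b → Set _
  Maps A onto B = A ⊆ ⟦_⟧ ⊢ B × B ⊆ image A

  onto⇒image≐ : {A : Pred F.Carrier a} {B : Pred G.Carrier b} →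
    (∀ {x y} → x G.≈ y → x ∈ B → y ∈ B) → Maps A onto B → image A ≐ B
  onto⇒image≐ B-resp (A→B , B→A) = (λ (x , x∈ , e) → B-resp e (A→B x∈)) , B→A

  onto-image : (A : Pred F.Carrier a) → Maps A onto image A
  onto-image A = (λ x∈ → _ , x∈ , G.refl) , id

  onto-U : IsSurjective → Maps U onto U
  onto-U φ-surj = _ , λ {y} _ → proj₁ (φ-surj y) , tt , proj₂ (φ-surj y) F.refl

  onto-· : ∀ {a b a′ b′} {A : Pred F.Carrier a} {B : Pred F.Carrier b}
    {A′ : Pred G.Carrier a′} {B′ : Pred G.Carrier b′} →
    Maps A onto A′ → Maps B onto B′ → Maps (A F.· B) onto (A′ G.· B′)
  onto-· (A→ , A←) (B→ , B←) =
      (λ (y , z , y∈ , z∈ , e) → ⟦ y ⟧ , ⟦ z ⟧ , A→ y∈ , B→ z∈ , G.trans (⟦⟧-cong e) (homo y z))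
    , λ (y , z , y∈ , z∈ , e) →
        let y′ , y′∈ , f = A← y∈
            z′ , z′∈ , g = B← z∈
        in y′ F.∙ z′ , (y′ , z′ , y′∈ , z′∈ , F.refl)
         , G.trans (homo _ _) (G.trans (G.∙-cong f g) (G.sym e))

  onto-commutators : ∀ {a b a′ b′} {A : Pred F.Carrier a} {B : Pred F.Carrier b}
    {A′ : Pred G.Carrier a′} {B′ : Pred G.Carrier b′} →
    Maps A onto A′ → Maps B onto B′ → Maps (F.Commutators A B) onto (G.Commutators A′ B′)
  onto-commutators (A→ , A←) (B→ , B←) =
      (λ (y , z , y∈ , z∈ , e) → ⟦ y ⟧ , ⟦ z ⟧ , A→ y∈ , B→ z∈ , G.trans (⟦⟧-cong e) (commutator-homo y z))
    , λ (y , z , y∈ , z∈ , e) →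
        let y′ , y′∈ , f = A← y∈
            z′ , z′∈ , g = B← z∈
        in y′ F.⁻¹ F.∙ z′ F.⁻¹ F.∙ y′ F.∙ z′ , (y′ , z′ , y′∈ , z′∈ , F.refl)
         , G.trans (commutator-homo y′ z′) (G.trans
             (G.∙-cong (G.∙-cong (G.∙-cong (G.⁻¹-cong f) (G.⁻¹-cong g)) f) g) (G.sym e))

  module _ (em : ∀ {ℓ} → ExcludedMiddle ℓ) where

    -- If `y` is not in the image, points outside `C` have neighbourhoods missing `C`, and points of
    -- `C` have images separated from `y`. The tube lemma combines these into a neighbourhood of `y`
    -- that misses the image.
    image-closed : {C : Pred F.Carrier c} → F.Closed C → G.closure (image C) ⊆ image C
    image-closed {C} closed-C {y} y∈ with em {P = y ∈ image C}
    ... | yes y∈image = y∈image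
    ... | no y∉image =
      let k , y∈k , apart = tube F.topology G.topology F.compact y R local
          y′ , y′∈k , x , x∈C , e = y∈ k y∈k
      in contradiction e (apart y′∈k x x∈C)
      where
      R : F.Carrier → G.Carrier → Set c
      R x y′ = x ∈ C → ¬ ⟦ x ⟧ G.≈ y′

      local : ∀ x → ∃₂ λ i j → x ∈ F.Basic i × y ∈ G.Basic j ×
        (∀ {x′ y′} → x′ ∈ F.Basic i → y′ ∈ G.Basic j → R x′ y′)
      local x with em {P = x ∈ C}
      ... | no x∉C =
        let i , x∈i , i⊆ = closed-C x∉C
            j , y∈j      = G.Basic-covers y
        in i , j , x∈i , y∈j , λ x′∈i _ x′∈C → contradiction x′∈C (i⊆ x′∈i)
      ... | yes x∈C =
        let V , W , open-V , open-W , x∈V , y∈W , V∩W = G.hausdorff ⟦ x ⟧ y (λ e → y∉image (x , x∈C , e))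
            i , x∈i , i⊆ = continuous open-V x∈V
            j , y∈j , j⊆ = open-W y∈W
        in i , j , x∈i , y∈j , λ x′∈i y′∈j _ e → V∩W _ (G.open-respects open-V e (i⊆ x′∈i) , j⊆ y′∈j)

    closure-closed : (A : Pred F.Carrier ℓ) → F.Closed (F.closure A)
    closure-closed A {x} x∉ with em {P = ∃ λ i → x ∈ F.Basic i × ¬ (F.Basic i ≬ A)}
    ... | yes (i , x∈i , ¬i≬A) = i , x∈i , λ y∈i y∈ → ¬i≬A (y∈ i y∈i)
    ... | no ¬∃ = contradiction meets x∉
      where
      meets : x ∈ F.closure A
      meets i x∈i with em {P = F.Basic i ≬ A}
      ... | yes i≬A = i≬A
      ... | no ¬i≬A = contradiction (i , x∈i , ¬i≬A) ¬∃

    -- Continuity sends closure into closure. Conversely, the image of the closure is closed by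
    -- compactness and contains the abstract group generated by `B`.
    onto-⟪⟫ : {A : Pred F.Carrier c} {B : Pred G.Carrier c} → Maps A onto B → Maps F.⟪ A ⟫ onto G.⟪ B ⟫
    onto-⟪⟫ {A} {B} (A→ , A←) = to , from
      where
      generated→ : F.Generated A ⊆ ⟦_⟧ ⊢ G.Generated B
      generated→ = F.generated-least (preimage-isSubgroup (G.generated-isSubgroup B)) (G.gen ∘ A→)

      generated← : G.Generated B ⊆ image (F.Generated A)
      generated← = G.generated-least (image-isSubgroup (F.generated-isSubgroup A))
        (λ y∈B → let x , x∈A , e = A← y∈B in x , F.gen x∈A , e)

      to : F.⟪ A ⟫ ⊆ ⟦_⟧ ⊢ G.⟪ B ⟫
      to x∈ i ⟦x⟧∈i =
        let j , x∈j , j⊆ = continuous (λ y∈i → i , y∈i , id) ⟦x⟧∈i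
            a , a∈j , a∈ = x∈ j x∈j
        in ⟦ a ⟧ , j⊆ a∈j , generated→ a∈

      from : G.⟪ B ⟫ ⊆ image F.⟪ A ⟫
      from y∈ = image-closed (closure-closed (F.Generated A)) (G.closure-mono
        (λ z∈ → let x , x∈ , e = generated← z∈ in x , F.⊆closure x∈ , e) y∈)

    onto-℧₁ : {A : Pred F.Carrier c} {A′ : Pred G.Carrier c} → Maps A onto A′ → Maps (F.℧₁ p A) onto (G.℧₁ p A′)
    onto-℧₁ (A→ , A←) = onto-⟪⟫
      ( (λ (y , y∈ , e) → ⟦ y ⟧ , A→ y∈ , G.trans (⟦⟧-cong e) (pow-homo p y))
      , (λ (y , y∈ , e) → let y′ , y′∈ , f = A← y∈ in
          F.pow p y′ , (y′ , y′∈ , F.refl) , G.trans (pow-homo p y′) (G.trans (G.pow-cong p f) (G.sym e))))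

    onto-Fr : {A : Pred F.Carrier c} {A′ : Pred G.Carrier c} → Maps A onto A′ → Maps (F.Fr p A) onto (G.Fr p A′)
    onto-Fr A↠ = onto-· (onto-℧₁ A↠) (onto-⟪⟫ (onto-commutators A↠ A↠))

    -- The saturation `D` of `H` is open, so its complement is closed and has closed image. By
    -- surjectivity that image is the complement of `image H`.
    image-open : IsSurjective → {H : Pred F.Carrier c} → F.IsSubgroup H → F.Open H → G.Open (image H)
    image-open φ-surj {H} H≤ open-H {y} (x , x∈H , ⟦x⟧≈y) with em {P = ∃ λ i → y ∈ G.Basic i × G.Basic i ⊆ image H}
    ... | yes found = found
    ... | no ¬found =
      let z , z∉D , ⟦z⟧≈y = image-closed ∁D-closed meets
      in contradiction (x , x∈H , G.trans ⟦x⟧≈y (G.sym ⟦z⟧≈y)) z∉D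
      where
      D : Pred F.Carrier c
      D = ⟦_⟧ ⊢ image H

      D≤ : F.IsSubgroup D
      D≤ = preimage-isSubgroup (image-isSubgroup H≤)

      ∁D-closed : F.Closed (∁ D)
      ∁D-closed {x} x∈∁∁D with em {P = x ∈ D}
      ... | no x∉D  = contradiction x∉D x∈∁∁D
      ... | yes x∈D =
        let i , x∈i , i⊆D = F.⊇open⇒open D≤ open-H (F.IsSubgroup.ε-closed H≤) (λ z∈H → _ , z∈H , G.refl) x∈D
        in i , x∈i , λ z∈i z∉D → z∉D (i⊆D z∈i)

      meets : y ∈ G.closure (image (∁ D))
      meets i y∈i with em {P = G.Basic i ≬ image (∁ D)}
      ... | yes i≬ = i≬
      -- A basic neighbourhood missing the image of the complement of `D` would lie in `image H`,
      -- contrary to the choice of `y`.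
      ... | no ¬i≬ = contradiction (i , y∈i , λ {w} → inside {w}) ¬found
        where
        inside : G.Basic i ⊆ image H
        inside {w} w∈i with φ-surj w
        ... | z , ⟦z⟧ with em {P = z ∈ D}
        ...   | yes z∈D = G.IsSubgroup.respects (image-isSubgroup H≤) (⟦z⟧ F.refl) z∈D
        ...   | no z∉D  = contradiction (w , w∈i , z , z∉D , ⟦z⟧ F.refl) ¬i≬

proposition3p4 : (∀ {ℓ} → ExcludedMiddle ℓ) →
    ∀ {c} (p : ℕ) → Prime p → ¬ (2 ∣ p) →
    (n : ℕ) (F : ProPGroup p c) (x : Fin n → ProPGroup.Carrier F) → IsFree F x →
    (E : Pred (ProPGroup.Carrier F) c) →
    ProPGroup.IsSubgroup F E → ProPGroup.Open F E → IsCharacteristic F E →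
    (G : ProPGroup p c) → ProPGroup.d≤_ G n →
    (φ : Hom F G) → Hom.IsSurjective φ →
    ProPGroup.IsPowerful G p (Hom.image φ E) ⇔
    (Hom.image φ (E₂ F E) ≐ Hom.image φ (E₁ F E))
proposition3p4 em p pp _ n F x _ E E≤ open-E E-char G (_ , (generators , _) , _) φ φ-surj = mk⇔ to from
  where
  open ProPGroup G
  open ProPGroupProperties G

  H : Pred Carrier _
  H = Hom.image φ E

  H⊴ : IsNormalSubgroup H
  H⊴ = image-normal φ φ-surj (characteristic⇒normal F E≤ E-char)

  H≤ : IsSubgroup H
  H≤ = IsNormalSubgroup.isSubgroup H⊴

  open-H : Open H
  open-H = image-open φ em φ-surj E≤ open-E

  -- This and `image-E₂` turn the comparison of `E₁` and `E₂` into a statement about `H` inside `G`.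
  image-E₁ : Hom.image φ (E₁ F E) ≐ Fr p H
  image-E₁ = onto⇒image≐ φ ·-respects (onto-Fr φ em (onto-image φ E))

  image-E₂ : Hom.image φ (E₂ F E) ≐ ℧₁ p H · [ U , Fr p H ]
  image-E₂ = onto⇒image≐ φ ·-respects (onto-· φ (onto-℧₁ φ em (onto-image φ E))
    (onto-⟪⟫ φ em (onto-commutators φ (onto-U φ φ-surj) (onto-Fr φ em (onto-image φ E)))))

  to : IsPowerful p H → Hom.image φ (E₂ F E) ≐ Hom.image φ (E₁ F E)
  to powerful =
      (λ y∈ → proj₂ image-E₁ (E₂⊆Fr (proj₁ image-E₂ y∈)))
    , (λ y∈ → proj₂ image-E₂ (⊆·⟪⟫ _ _ (Fr⊆ (proj₁ image-E₁ y∈))))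
    where
    Fr⊆ : Fr p H ⊆ ℧₁ p H
    Fr⊆ = proj₂ (IsPowerful.℧₁≐Fr powerful)

    -- Powerfulness places `Fr p H` in the closed normal subgroup `℧₁ p H`, which then absorbs the
    -- commutators with `U`.
    E₂⊆Fr : ℧₁ p H · [ U , Fr p H ] ⊆ Fr p H
    E₂⊆Fr (y , z , y∈ , z∈ , e) = ℧₁⊆Fr H (respects (sym e) (∙-closed y∈ ([U,]⊆ (℧₁-normal H⊴) Fr⊆ z∈)))
      where open IsSubgroup (IsNormalSubgroup.isSubgroup (℧₁-normal H⊴))

  from : Hom.image φ (E₂ F E) ≐ Hom.image φ (E₁ F E) → IsPowerful p H
  from (_ , E₁⊆E₂) = record
    { isSubgroup          = H≤
    ; isClosed            = open⇒closed H≤ open-H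
    ; isFinitelyGenerated = schreier G H⊴ open-H generators
    ; ℧₁≐Fr               = ℧₁⊆Fr H , Fr⊆℧₁ em pp H⊴ (proj₁ image-E₂ ∘ E₁⊆E₂ ∘ proj₂ image-E₁)
    }
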